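{- For each integer $k\ge 1$, there exists a positive integer $n_0=n_0(k)$ such that for all even $n\ge n_0$, $$R(C_n,B_n^{(k)})=(k+1)(n-1)+1.$$
   Context: All graphs are finite and simple. For graphs $G,H$, the Ramsey number $R(G,H)$ is the minimum $N$ such that every graph $\Gamma$ on $N$ vertices contains a copy of $G$ (as a not necessarily induced subgraph) or has complement containing a copy of $H$. $C_n$ denotes the cycle of length $n$. For positive integers $k,n$, the book graph $B_n^{(k)}$ is the graph consisting of $n$ copies of the complete graph $K_{k+1}$ all sharing a common $K_k$ (i.e. a $K_k$ together with $n$ further pairwise non-adjacent vertices, each adjacent to all vertices of the $K_k$). -}

module Defs where

open import Data.Fin.Base using (Fin; toℕ)
open import Data.Fin.Properties using () renaming (_≟_ to _≟ᶠ_)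
open import Data.Nat.Base using (ℕ; zero; suc; _+_; _≤_; _<_)
open import Data.Nat.Properties using (_≟_; _<?_)
open import Data.Product.Base using (Σ-syntax; _×_; _,_)
open import Data.Sum.Base using (_⊎_; swap)
open import Function.Base using (_∘_)
open import Function.Bundles using (_↣_; module Injection)
open import Level using (0ℓ)
open import Relation.Binary.Core using (Rel)
open import Relation.Binary.Definitions using (Decidable; Irreflexive; Symmetric)
open import Relation.Binary.PropositionalEquality using (_≡_; _≢_; ≢-sym)
open import Relation.Nullary.Decidable using (¬?; _×-dec_; _⊎-dec_)
open import Relation.Nullary.Negation using (¬_)

-- Finite simple graphs on the vertex set Fin n. Decidability of adjacency is
-- the constructive content of the graph being a finite object.
record Graph (n : ℕ) : Set₁ where
  field
    Adj    : Rel (Fin n) 0ℓ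
    sym    : Symmetric Adj
    irrefl : Irreflexive _≡_ Adj
    adj?   : Decidable Adj

open Graph public using (Adj)

complement : ∀ {n} → Graph n → Graph n
complement G = record
  { Adj    = λ i j → i ≢ j × ¬ Adj G i j
  ; sym    = λ (i≢j , ¬ij) → ≢-sym i≢j , ¬ij ∘ Graph.sym G
  ; irrefl = λ i≡j (i≢j , _) → i≢j i≡j
  ; adj?   = λ i j → ¬? (i ≟ᶠ j) ×-dec ¬? (Graph.adj? G i j)
  }

-- Γ contains a (not necessarily induced) copy of G.
Contains : ∀ {m n} → Graph n → Graph m → Set
Contains {m} {n} Γ G =
  Σ[ f ∈ Fin m ↣ Fin n ]
    (∀ i j → Adj G i j → Adj Γ (Injection.to f i) (Injection.to f j))

RamseyProperty : ∀ {l m} → Graph l → Graph m → ℕ → Set₁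
RamseyProperty G H N =
  (Γ : Graph N) → Contains Γ G ⊎ Contains (complement Γ) H

-- "R(G,H) = N". A relation, rather than a function, since the existence of a
-- suitable N is Ramsey's theorem; such an N is unique by antisymmetry of ≤.
IsRamseyNumber : ∀ {l m} → Graph l → Graph m → ℕ → Set₁
IsRamseyNumber G H N =
  RamseyProperty G H N × (∀ M → RamseyProperty G H M → N ≤ M)

-- j is i + 1 modulo n.
CyclicSuc : ∀ {n} → Rel (Fin n) 0ℓ
CyclicSuc {n} i j = suc (toℕ i) ≡ toℕ j ⊎ (suc (toℕ i) ≡ n × toℕ j ≡ zero)

cyclicSuc? : ∀ {n} → Decidable (CyclicSuc {n})
cyclicSuc? {n} i j =
  (suc (toℕ i) ≟ toℕ j) ⊎-dec ((suc (toℕ i) ≟ n) ×-dec (toℕ j ≟ zero))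

-- The cycle Cₙ for n ≥ 3. For n < 3, where Cₙ is not a simple graph, this is
-- the complete graph Kₙ; the condition i ≢ j only matters when n ≡ 1.
cycle : ∀ n → Graph n
cycle n = record
  { Adj    = λ i j → i ≢ j × (CyclicSuc i j ⊎ CyclicSuc j i)
  ; sym    = λ (i≢j , e) → ≢-sym i≢j , swap e
  ; irrefl = λ i≡j (i≢j , _) → i≢j i≡j
  ; adj?   = λ i j → ¬? (i ≟ᶠ j) ×-dec (cyclicSuc? i j ⊎-dec cyclicSuc? j i)
  }

-- The book graph Bₙ⁽ᵏ⁾: the vertices numbered below k form the common Kₖ, and
-- the other n vertices are the pages.
book : ∀ k n → Graph (k + n)
book k n = record
  { Adj    = λ i j → i ≢ j × (toℕ i < k ⊎ toℕ j < k)
  ; sym    = λ (i≢j , e) → ≢-sym i≢j , swap e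
  ; irrefl = λ i≡j (i≢j , _) → i≢j i≡j
  ; adj?   = λ i j → ¬? (i ≟ᶠ j) ×-dec ((toℕ i <? k) ⊎-dec (toℕ j <? k))
  }

{-# OPTIONS --safe #-}
module Submission where

-- Upper bound. If some v has fewer than n vertices in its closed neighbourhood
-- within the current vertex set, delete that neighbourhood and add v to the
-- spine of a book with k − 1 spine vertices found in the rest. Otherwise all
-- degrees are at least n − 1 = 2p − 1, while the order is at most K p. A cut that
-- no single move improves leaves a bipartite graph of minimum degree ≥ p, and it
-- suffices to find a C₂ₚ there, for p large in terms of K:
--   * Let x be the start of a maximal path. The neighbours of x lie at odd
--     positions of the path; unless one of them lies beyond position 4p − 4, two
--     are 2p − 2 apart and close a C₂ₚ with x. So there is a cycle of length
--     ≥ 4p − 2.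
--   * Among boundedly many consecutive vertices of a path, t of them have t common
--     neighbours, which lie either all off the path or all within a bounded
--     stretch of it. The path can then be rerouted through this K_{t,t}: it gets
--     shorter, but only by a bounded amount.
--   * Rerouting the long cycle once, with t large, inserts a zigzag of adjustable
--     even length; rerouting the remaining path again and again brings the total
--     length within the range of that adjustment, and parity does the rest.
-- Lower bound: k + 1 disjoint cliques on n − 1 vertices.

open import Defs
open import Data.Nat.Base using (ℕ; _+_; _*_; _∸_; _≥_)
open import Data.Nat.Divisibility using (_∣_)
open import Data.Product.Base using (_×_; ∃-syntax)

import Algebra.Solver.CommutativeMonoid as CMSolver
open import Data.Bool.Base using (Bool; true; false; not)
open import Data.Bool.Properties using (not-¬; ¬-not; not-involutive) renaming (_≟_ to _≟ᵇ_)
open import Data.Empty using (⊥-elim)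
import Data.Fin.Base as Fin
open import Data.Fin.Base
  using (Fin; zero; suc; toℕ; cast; inject₁; inject≤; remQuot; combine; _↑ˡ_; _↑ʳ_)
open import Data.Fin.Induction using (<-weakInduction)
open import Data.Fin.Properties
  using (toℕ-injective; toℕ-cast; toℕ<n; toℕ-inject₁; toℕ-↑ˡ; toℕ-↑ʳ; ↑ʳ-injective; ↑ˡ-injective; inject≤-injective; combine-remQuot; pigeonhole)
  renaming (_≟_ to _≟ᶠ_)
open import Data.List.Base
  using (List; []; _∷_; _++_; [_]; length; map; filter; take; drop; lookup; allFin)
open import Data.List.Membership.Propositional using (_∈_; _∉_; find; lose)
open import Data.List.Membership.Propositional.Properties
  using (∈-∃++; ∈-++⁺ˡ; ∈-++⁺ʳ; ∈-++⁻; ∈-filter⁺; ∈-filter⁻; ∈-insert; ∈-lookup)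
open import Data.List.Properties
  using (length-++; filter-accept; filter-reject; filter-none; filter-++; length-filter; ++-assoc; length-take; length-drop; take++drop≡id; ++-identityʳ; length-tabulate)
open import Data.List.Relation.Binary.Disjoint.Propositional using (Disjoint)
open import Data.List.Relation.Binary.Permutation.Propositional
  using (_↭_; ↭-sym; ↭-refl; ↭-reflexive; ↭⇒↭ₛ; ↭-trans)
open import Data.List.Relation.Binary.Permutation.Propositional.Properties
  using (∈-resp-↭; ↭-length; ++-commutativeMonoid; shifts; shift)
  renaming (++⁺ʳ to ↭-++⁺ʳ; ++⁺ˡ to ↭-++⁺ˡ)
import Data.List.Relation.Binary.Permutation.Setoid.Properties as ↭ₛ
open import Data.List.Relation.Binary.Sublist.Propositional
  using ([]; _∷_; _∷ʳ_; ⊆-refl; ⊆-trans; minimum)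
  renaming (_⊆_ to _⊑_; lookup to ⊑⇒⊆)
open import Data.List.Relation.Binary.Sublist.Propositional.Properties
  using (All-resp-⊆; length-mono-≤; filter-⊆; take-⊆; drop-⊆; ++⁺; ++⁺ˡ; ++⁺ʳ)
open import Data.List.Relation.Binary.Subset.Propositional using (_⊆_)
open import Data.List.Relation.Unary.All as All using (All; []; _∷_; all?)
import Data.List.Relation.Unary.All.Properties as All
open import Data.List.Relation.Unary.AllPairs using ([]; _∷_)
open import Data.List.Relation.Unary.Any using (here; there; Any; any?)
open import Data.List.Relation.Unary.Unique.Propositional using (Unique)
import Data.List.Relation.Unary.Unique.Propositional.Properties as Unique
open import Data.Nat.Base using (zero; suc; _^_; _≤_; _<_; z≤n; s≤s; s≤s⁻¹; NonZero; _⊓_)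
open import Data.Nat.DivMod using (_/_; _%_; m/n*n≤m; m≡m%n+[m/n]*n; m%n<n)
open import Data.Nat.Divisibility using (divides)
open import Data.Nat.ListAction using (sum)
open import Data.Nat.Properties
open import Data.Nat.Tactic.RingSolver using (solve-∀)
open import Data.Product.Base using (_,_; proj₁; proj₂)
open import Data.Sum.Base using (_⊎_; inj₁; inj₂; [_,_]′)
open import Function.Base using (_∘_; id)
open import Function.Bundles using (mk↣; module Injection)
open import Function.Definitions using (Injective)
open import Level using (0ℓ)
open import Relation.Binary.Core using (Rel)
open import Relation.Binary.Definitions
  using (Symmetric; DecidableEquality)
  renaming (Decidable to Decidable₂)
open import Relation.Binary.PropositionalEquality
  using (_≡_; _≢_; refl; sym; trans; cong; cong₂; subst; setoid; module ≡-Reasoning)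
open import Relation.Nullary using (¬_; yes; no; contradiction)
open import Relation.Nullary.Decidable using (does; dec-true; dec-false; ¬?; _×-dec_; _⊎-dec_)
open import Relation.Unary using (Pred; Decidable)
open import Relation.Unary.Properties using (∁?)

+-swapˡ : ∀ x y z → x + (y + z) ≡ y + (x + z)
+-swapˡ x y z = trans (sym (+-assoc x y z)) (trans (cong (_+ z) (+-comm x y)) (+-assoc y x z))

-- Duplicate-free lists and sublists.

module _ {A : Set} where

  unique-⊑ : ∀ {xs ys : List A} → xs ⊑ ys → Unique ys → Unique xs
  unique-⊑ []         []       = []
  unique-⊑ (_ ∷ʳ τ)   (_ ∷ u)  = unique-⊑ τ u
  unique-⊑ (refl ∷ τ) (y≢ ∷ u) = All-resp-⊆ τ y≢ ∷ unique-⊑ τ u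

  unique-length-≤ : ∀ {xs ys : List A} → Unique xs → xs ⊆ ys → length xs ≤ length ys
  unique-length-≤ {[]}     _        _     = z≤n
  unique-length-≤ {x ∷ xs} (x≢ ∷ u) xs⊆ys with ∈-∃++ (xs⊆ys (here refl))
  ... | as , bs , refl = begin
    suc (length xs)               ≤⟨ s≤s (unique-length-≤ u xs⊆) ⟩
    suc (length (as ++ bs))       ≡⟨ cong suc (length-++ as) ⟩
    suc (length as + length bs)   ≡⟨ +-suc (length as) (length bs) ⟨
    length as + suc (length bs)   ≡⟨ length-++ as ⟨
    length (as ++ x ∷ bs)         ∎
    where
    open ≤-Reasoning
    xs⊆ : xs ⊆ as ++ bs
    xs⊆ y∈ with ∈-++⁻ as (xs⊆ys (there y∈))
    ... | inj₁ y∈as         = ∈-++⁺ˡ y∈as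
    ... | inj₂ (here refl)  = contradiction refl (All.lookup x≢ y∈)
    ... | inj₂ (there y∈bs) = ∈-++⁺ʳ as y∈bs

  unique-++⁻-disjoint : ∀ (xs : List A) {ys} → Unique (xs ++ ys) → Disjoint xs ys
  unique-++⁻-disjoint (x ∷ xs) (x≢ ∷ u) (here refl , z∈ys) =
    All.lookup x≢ (∈-++⁺ʳ xs z∈ys) refl
  unique-++⁻-disjoint (x ∷ xs) (x≢ ∷ u) (there z∈xs , z∈ys) =
    unique-++⁻-disjoint xs u (z∈xs , z∈ys)

  unique-∉ : ∀ (xs : List A) {ys z} → Unique (xs ++ z ∷ ys) → z ∉ xs ++ ys
  unique-∉ []       (z≢ ∷ _) z∈         = All.lookup z≢ z∈ refl
  unique-∉ (x ∷ xs) (x≢ ∷ _) (here refl) = All.lookup x≢ (∈-insert xs) refl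
  unique-∉ (x ∷ xs) (_ ∷ u)  (there z∈)  = unique-∉ xs u z∈

  unique-swap : ∀ (xs : List A) {ys} → Unique (xs ++ ys) → Unique (ys ++ xs)
  unique-swap xs {ys} u = Unique.++⁺ (unique-⊑ (++⁺ˡ xs ⊆-refl) u) (unique-⊑ (++⁺ʳ ys ⊆-refl) u)
    λ (z∈ys , z∈xs) → unique-++⁻-disjoint xs u (z∈xs , z∈ys)

  ⊑-++-∷ : ∀ (as : List A) {m bs} → as ++ bs ⊑ as ++ m ∷ bs
  ⊑-++-∷ as = ++⁺ (⊆-refl {x = as}) (_ ∷ʳ ⊆-refl)

  split-first : ∀ {a : A} {us xs} → a ∷ us ⊑ xs → ∃[ as ] ∃[ bs ] (xs ≡ as ++ a ∷ bs × us ⊑ bs)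
  split-first (y ∷ʳ τ) with split-first τ
  ... | as , bs , refl , τ′ = y ∷ as , bs , refl , τ′
  split-first (refl ∷ τ) = [] , _ , refl , τ

  split-last : ∀ k {us xs : List A} → us ⊑ xs → length us ≡ suc k →
    ∃[ mid ] ∃[ as ] ∃[ b ] ∃[ bs ]
      (us ≡ mid ++ [ b ] × xs ≡ as ++ b ∷ bs × mid ⊑ as × length mid ≡ k)
  split-last k (y ∷ʳ τ) eq with split-last k τ eq
  ... | mid , as , b , bs , refl , refl , τ′ , l = mid , y ∷ as , b , bs , refl , refl , y ∷ʳ τ′ , l
  split-last zero {us = a ∷ []} (refl ∷ τ) eq = [] , [] , a , _ , refl , refl , [] , refl
  split-last (suc k) {us = a ∷ us} (refl ∷ τ) eq with split-last k τ (suc-injective eq)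
  ... | mid , as , b , bs , refl , refl , τ′ , l =
    a ∷ mid , a ∷ as , b , bs , refl , refl , refl ∷ τ′ , cong suc l

  -- Meant for one side of a complete bipartite graph found along a path: its outermost vertices
  -- become the places where the path is cut, and its other vertices lie in the stretch between
  -- them.
  split-ends : ∀ k {us xs : List A} → us ⊑ xs → length us ≡ 2 + k →
    ∃[ as ] ∃[ a ] ∃[ ms ] ∃[ b ] ∃[ bs ] ∃[ mid ]
      (us ≡ a ∷ mid ++ [ b ] × xs ≡ as ++ a ∷ ms ++ b ∷ bs × mid ⊑ ms × length mid ≡ k)
  split-ends k {us = a ∷ us} τ eq with split-first τ
  ... | as , ts , refl , τ′ with split-last k τ′ (suc-injective eq)
  ...   | mid , ms , b , bs , refl , refl , τ″ , l =
    as , a , ms , b , bs , mid , refl , refl , τ″ , l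

-- Counting and averaging in lists.

module _ {A : Set} where

  count : {P : Pred A 0ℓ} → Decidable P → List A → ℕ
  count P? xs = length (filter P? xs)

  count-++ : ∀ {P : Pred A 0ℓ} (P? : Decidable P) xs {ys} → count P? (xs ++ ys) ≡ count P? xs + count P? ys
  count-++ P? xs {ys} = trans (cong length (filter-++ P? xs ys)) (length-++ (filter P? xs))

  count-∁ : ∀ {P : Pred A 0ℓ} (P? : Decidable P) xs → count P? xs + count (∁? P?) xs ≡ length xs
  count-∁ P? [] = refl
  count-∁ P? (x ∷ xs) with P? x
  ... | yes _ = cong suc (count-∁ P? xs)
  ... | no  _ = trans (+-suc _ _) (cong suc (count-∁ P? xs))

  count-split : ∀ {P Q : Pred A 0ℓ} (P? : Decidable P) (Q? : Decidable Q) {xs} ys zs → Unique xs →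
    (∀ {x} → x ∈ xs → P x → (x ∈ ys × Q x) ⊎ x ∈ zs) → count P? xs ≤ count Q? ys + length zs
  count-split P? Q? {xs} ys zs u f = begin
    count P? xs                        ≤⟨ unique-length-≤ (Unique.filter⁺ P? u) incl ⟩
    length (filter Q? ys ++ zs)        ≡⟨ length-++ (filter Q? ys) ⟩
    count Q? ys + length zs            ∎
    where
    open ≤-Reasoning
    incl : filter P? xs ⊆ filter Q? ys ++ zs
    incl x∈ with ∈-filter⁻ P? {xs = xs} x∈
    ... | x∈xs , px with f x∈xs px
    ...   | inj₁ (x∈ys , qx) = ∈-++⁺ˡ (∈-filter⁺ Q? x∈ys qx)
    ...   | inj₂ x∈zs        = ∈-++⁺ʳ (filter Q? ys) x∈zs

  -- Averaging over at most `q` consecutive blocks of length at most `d`: if each held fewer than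
  -- `s` hits, the total could not exceed `q * s`.
  dense-chunk : ∀ {P : Pred A 0ℓ} (P? : Decidable P) d s q xs → length xs ≤ q * d → q * s < count P? xs →
    ∃[ as ] ∃[ bs ] ∃[ cs ] (xs ≡ as ++ bs ++ cs × length bs ≤ d × s ≤ count P? bs)
  dense-chunk P? d s zero    []  _  ()
  dense-chunk P? d s (suc q) xs len cnt with s ≤? count P? (take d xs)
  ... | yes s≤ = [] , take d xs , drop d xs , sym (take++drop≡id d xs) ,
    subst (_≤ d) (sym (length-take d xs)) (m⊓n≤m d (length xs)) , s≤
  ... | no  s≰ with dense-chunk P? d s q (drop d xs)
                      (subst (_≤ q * d) (sym (length-drop d xs)) (m≤n+o⇒m∸n≤o _ d len)) rest
    where
    rest : q * s < count P? (drop d xs)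
    rest = +-cancelˡ-< s _ _ (begin-strict
      s + q * s                                     <⟨ cnt ⟩
      count P? xs                                   ≡⟨ cong (count P?) (take++drop≡id d xs) ⟨
      count P? (take d xs ++ drop d xs)             ≡⟨ count-++ P? (take d xs) ⟩
      count P? (take d xs) + count P? (drop d xs)   ≤⟨ +-monoˡ-≤ _ (≰⇒≥ s≰) ⟩
      s + count P? (drop d xs)                      ∎)
      where open ≤-Reasoning
  ...   | as , bs , cs , eq , l , c = take d xs ++ as , bs , cs ,
    trans (sym (take++drop≡id d xs)) (trans (cong (take d xs ++_) eq) (sym (++-assoc (take d xs) as _))) , l , c

  sum-≤ : ∀ {Q : Pred A 0ℓ} (Q? : Decidable Q) (f : A → ℕ) t d xs →
    (∀ x → f x ≤ d) → (∀ x → ¬ Q x → f x ≤ t) → sum (map f xs) ≤ t * length xs + d * count Q? xs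
  sum-≤ Q? f t d []       _  _ = z≤n
  sum-≤ Q? f t d (x ∷ xs) ≤d ≤t with Q? x | sum-≤ Q? f t d xs ≤d ≤t
  ... | yes q | ih = begin
    f x + sum (map f xs)                                  ≤⟨ +-mono-≤ (≤d x) ih ⟩
    d + (t * length xs + d * count Q? xs)                 ≡⟨ +-swapˡ d (t * length xs) _ ⟩
    t * length xs + (d + d * count Q? xs)                 ≡⟨ cong (t * length xs +_) (*-suc d _) ⟨
    t * length xs + d * suc (count Q? xs)                 ≤⟨ +-monoˡ-≤ _ (*-monoʳ-≤ t (n≤1+n _)) ⟩
    t * suc (length xs) + d * suc (count Q? xs)           ∎
    where open ≤-Reasoning
  ... | no ¬q | ih = begin
    f x + sum (map f xs)                                  ≤⟨ +-mono-≤ (≤t x ¬q) ih ⟩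
    t + (t * length xs + d * count Q? xs)                 ≡⟨ +-assoc t _ _ ⟨
    t + t * length xs + d * count Q? xs                   ≡⟨ cong (_+ d * count Q? xs) (*-suc t _) ⟨
    t * suc (length xs) + d * count Q? xs                 ∎
    where open ≤-Reasoning

-- Paths, zigzags and complete bipartite subgraphs.

module Walks {V : Set} (E : Rel V 0ℓ) where

  -- The list consists of the vertices after the first one, so that a closed
  -- path x ⋯ x with a duplicate-free list is a cycle (of length ≥ 3).
  data Path : V → V → List V → Set where
    []  : ∀ {x} → Path x x []
    _∷_ : ∀ {x y z xs} → E x y → Path y z xs → Path x z (y ∷ xs)

  infixr 5 _++ᵖ_

  _++ᵖ_ : ∀ {x y z xs ys} → Path x y xs → Path y z ys → Path x z (xs ++ ys)
  []      ++ᵖ q = q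
  (e ∷ p) ++ᵖ q = e ∷ (p ++ᵖ q)

  split : ∀ {x y z} xs {ys} → Path x z (xs ++ y ∷ ys) → Path x y (xs ++ [ y ]) × Path y z ys
  split []       (e ∷ p) = e ∷ [] , p
  split (x ∷ xs) (e ∷ p) with split xs p
  ... | p₁ , p₂ = e ∷ p₁ , p₂

  Cycle : ℕ → Set
  Cycle n = ∃[ x ] ∃[ xs ] (Path x x xs × Unique xs × length xs ≡ n)

  module _ (E-sym : Symmetric E) where

    -- The path alternates between `ws` and `us`, starting at `a`. Since `b` is joined to all of
    -- `ws`, it can turn to `b` after any vertex of `ws`; by then it has used `i` vertices of `us`
    -- and `i + 1` of `ws`.
    zigzag : ∀ i {a b} ws us → i < length ws → i ≤ length us →
      All (λ u → All (E u) ws) (a ∷ us) → All (E b) ws → Unique (ws ++ us ++ [ b ]) →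
      ∃[ zs ] (Path a b zs × length zs ≡ 2 * suc i × Unique zs × zs ⊆ ws ++ us ++ [ b ])
    zigzag zero {a} {b} (w ∷ ws) us _ _ ((aw ∷ _) ∷ _) (bw ∷ _) (w≢ ∷ _) =
      w ∷ b ∷ [] , aw ∷ E-sym bw ∷ [] , refl ,
      (All.lookup w≢ (∈-++⁺ʳ ws (∈-++⁺ʳ us (here refl))) ∷ []) ∷ [] ∷ [] ,
      λ { (here refl) → here refl
        ; (there (here refl)) → ∈-++⁺ʳ (w ∷ ws) (∈-++⁺ʳ us (here refl)) }
    zigzag (suc i) {a} {b} (w ∷ ws) (u ∷ us) (s≤s i<) (s≤s i≤) ((aw ∷ _) ∷ u~ ∷ us~) (bw ∷ b~) (w≢ ∷ uq)
      with zigzag i {u} {b} ws us i< i≤ (All.map All.tail (u~ ∷ us~)) b~ (unique-⊑ (⊑-++-∷ ws) uq)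
    ... | zs , path , len , uzs , zs⊆ =
      w ∷ u ∷ zs , aw ∷ E-sym (All.head u~) ∷ path , len′ ,
      (All.lookup w≢ (∈-insert ws) ∷ All.tabulate (λ z∈ → All.lookup w≢ (widen (zs⊆ z∈))))
        ∷ All.tabulate (λ { z∈ refl → u∉ (zs⊆ z∈) }) ∷ uzs ,
      λ { (here refl) → here refl
        ; (there (here refl)) → there (∈-insert ws)
        ; (there (there z∈)) → there (widen (zs⊆ z∈)) }
      where
      widen : ws ++ us ++ [ b ] ⊆ ws ++ u ∷ us ++ [ b ]
      widen = ⊑⇒⊆ (⊑-++-∷ ws)
      u∉ : u ∉ ws ++ us ++ [ b ]
      u∉ = unique-∉ ws uq
      len′ : suc (suc (length zs)) ≡ 2 * suc (suc i)
      len′ = trans (cong (2 +_) len) (sym (*-suc 2 (suc i)))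

  module _ (E? : Decidable₂ E) where

    -- The edges between `xs` and `ys` are counted from both ends; `expand` distributes the edges at
    -- one vertex of `xs` over the vertices of `ys`.
    double-count : ∀ p xs ys → All (λ x → p ≤ count (E? x) ys) xs →
      length xs * p ≤ sum (map (λ y → count (λ x → E? x y) xs) ys)
    double-count p []       ys _          = z≤n
    double-count p (x ∷ xs) ys (x≥ ∷ xs≥) = begin
      p + length xs * p                  ≤⟨ +-mono-≤ x≥ (double-count p xs ys xs≥) ⟩
      count (E? x) ys + degrees xs ys    ≡⟨ expand ys ⟨
      degrees (x ∷ xs) ys                ∎
      where
      open ≤-Reasoning
      degrees : List V → List V → ℕ
      degrees xs ys = sum (map (λ y → count (λ x → E? x y) xs) ys)
      expand : ∀ ys → degrees (x ∷ xs) ys ≡ count (E? x) ys + degrees xs ys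
      expand [] = refl
      expand (y ∷ ys) with E? x y
      ... | yes _ = cong suc (trans (cong (count (λ x → E? x y) xs +_) (expand ys)) (+-swapˡ (count (λ x → E? x y) xs) (count (E? x) ys) _))
      ... | no  _ = trans (cong (count (λ x → E? x y) xs +_) (expand ys)) (+-swapˡ (count (λ x → E? x y) xs) (count (E? x) ys) _)

    -- There are at least `2 * tK * p` edges between the two lists. The vertices of `ys` with few
    -- neighbours account for at most `suc t` edges each, hence for at most `tK * p`. Each of the
    -- others has at most `2 * tK` edges, so covering the rest takes at least p/2 of them.
    many-neighbours : ∀ p K t xs ys → All (λ x → p ≤ count (E? x) ys) xs →
      length xs ≡ 2 * (suc t * suc K) → length ys ≤ suc K * p →
      p ≤ 2 * count (λ y → suc t ≤? count (λ x → E? x y) xs) ys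
    many-neighbours p K t xs ys deg len small = *-cancelˡ-≤ tK (+-cancelˡ-≤ (tK * p) _ _ (begin
      tK * p + tK * p                        ≡⟨ arith₁ tK p ⟩
      2 * tK * p                             ≡⟨ cong (_* p) len ⟨
      length xs * p                          ≤⟨ double-count p xs ys deg ⟩
      sum (map (λ y → count (λ x → E? x y) xs) ys)
        ≤⟨ sum-≤ Q? _ (suc t) (length xs) ys (λ y → length-filter (λ x → E? x y) xs) (λ y → ≰⇒≥) ⟩
      suc t * length ys + length xs * N      ≤⟨ +-monoˡ-≤ _ (*-monoʳ-≤ (suc t) small) ⟩
      suc t * (suc K * p) + length xs * N    ≡⟨ cong₂ _+_ (sym (*-assoc (suc t) (suc K) p)) (cong (_* N) len) ⟩
      tK * p + 2 * tK * N                    ≡⟨ cong (tK * p +_) (arith₂ tK N) ⟩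
      tK * p + tK * (2 * N)                  ∎))
      where
      open ≤-Reasoning
      tK = suc t * suc K
      Q? = λ y → suc t ≤? count (λ x → E? x y) xs
      N = count Q? ys
      arith₁ : ∀ a b → a * b + a * b ≡ 2 * a * b
      arith₁ = solve-∀
      arith₂ : ∀ a b → 2 * a * b ≡ a * (2 * b)
      arith₂ = solve-∀

    -- Kővári–Sós–Turán by successive halving of ws.
    complete-bipartite : ∀ k t xs ws → All (λ w → k ≤ count (λ x → E? x w) xs) ws →
      suc t * 2 ^ length xs ≤ length ws →
      ∃[ us ] ∃[ vs ] (us ⊑ xs × length us ≡ k × vs ⊑ ws × length vs ≡ suc t × All (λ u → All (E u) vs) us)
    complete-bipartite zero t xs ws _ len =
      [] , take (suc t) ws , minimum xs , refl , take-⊆ (suc t) ws ,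
      trans (length-take (suc t) ws) (m≤n⇒m⊓n≡m (≤-trans (m≤m*n (suc t) (2 ^ length xs) {{m^n≢0 2 (length xs)}}) len)) , []
    complete-bipartite (suc k) t [] [] _ ()
    complete-bipartite (suc k) t [] (w ∷ ws) (() ∷ _) len
    complete-bipartite (suc k) t (x ∷ xs) ws large len
      -- Keeping the neighbours of `x` puts `x` into `us` and lowers the demand on the remaining
      -- `xs` to `k`. Keeping the non-neighbours leaves the demand as it is, and all of it is met
      -- within `xs`. One of the two parts has half of the required size.
      with suc t * 2 ^ length xs ≤? count (E? x) ws
    ... | yes enough
      with complete-bipartite k t xs (filter (E? x) ws) (All.tabulate nbr) enough
      where
      nbr : ∀ {w} → w ∈ filter (E? x) ws → k ≤ count (λ x → E? x w) xs
      nbr {w} w∈ with ∈-filter⁻ (E? x) {xs = ws} w∈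
      ... | w∈ws , xw = s≤s⁻¹ (subst (λ l → suc k ≤ length l) (filter-accept (λ x → E? x w) xw) (All.lookup large w∈ws))
    ...   | us , vs , us⊑ , lu , vs⊑ , lv , uv =
      x ∷ us , vs , refl ∷ us⊑ , cong suc lu , ⊆-trans vs⊑ (filter-⊆ (E? x) ws) , lv ,
      All.tabulate (λ v∈ → proj₂ (∈-filter⁻ (E? x) {xs = ws} (⊑⇒⊆ vs⊑ v∈))) ∷ uv
    complete-bipartite (suc k) t (x ∷ xs) ws large len
      | no few
      with complete-bipartite (suc k) t xs (filter (∁? (E? x)) ws) (All.tabulate nbr) enough
      where
      nbr : ∀ {w} → w ∈ filter (∁? (E? x)) ws → suc k ≤ count (λ x → E? x w) xs
      nbr {w} w∈ with ∈-filter⁻ (∁? (E? x)) {xs = ws} w∈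
      ... | w∈ws , ¬xw = subst (λ l → suc k ≤ length l) (filter-reject (λ x → E? x w) ¬xw) (All.lookup large w∈ws)
      open ≤-Reasoning
      enough : suc t * 2 ^ length xs ≤ count (∁? (E? x)) ws
      enough = +-cancelˡ-≤ (suc t * 2 ^ length xs) _ _ (begin
        suc t * 2 ^ length xs + suc t * 2 ^ length xs ≡⟨ arith (suc t) (2 ^ length xs) ⟩
        suc t * 2 ^ suc (length xs)                   ≤⟨ len ⟩
        length ws                                     ≡⟨ count-∁ (E? x) ws ⟨
        count (E? x) ws + count (∁? (E? x)) ws        ≤⟨ +-monoˡ-≤ _ (≰⇒≥ few) ⟩
        suc t * 2 ^ length xs + count (∁? (E? x)) ws  ∎)
        where
        arith : ∀ a b → a * b + a * b ≡ a * (2 * b)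
        arith = solve-∀
    ...   | us , vs , us⊑ , lu , vs⊑ , lv , uv =
      us , vs , x ∷ʳ us⊑ , lu , ⊆-trans vs⊑ (filter-⊆ (∁? (E? x)) ws) , lv , uv

-- Constants of the rerouting argument.

unique-↭ : ∀ {A : Set} {xs ys : List A} → xs ↭ ys → Unique xs → Unique ys
unique-↭ σ = ↭ₛ.Unique-resp-↭ (setoid _) (↭⇒↭ₛ σ)

-- The length of the segment of the path that is searched for one side of a
-- K_{t,t}, t = 3 + r; the number of vertices with t neighbours in the segment
-- that provide the other side; the length of the stretch of the path in which
-- they are found if they lie on it. Opaque because of the exponential.
opaque
  segment : ℕ → ℕ → ℕ
  segment K r = 2 * (suc (2 + r) * suc K)

  segment-def : ∀ K r → segment K r ≡ 2 * (suc (2 + r) * suc K)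
  segment-def K r = refl

  supply : ℕ → ℕ → ℕ
  supply K r = suc (2 + r) * 2 ^ segment K r

  supply-def : ∀ K r → supply K r ≡ suc (2 + r) * 2 ^ segment K r
  supply-def K r = refl

  supply≢0 : ∀ K r → NonZero (4 * supply K r)
  supply≢0 K r = m*n≢0 4 (supply K r) {{_}} {{m*n≢0 (suc (2 + r)) (2 ^ segment K r) {{_}} {{m^n≢0 2 (segment K r)}}}}

  chunk : ℕ → ℕ → ℕ
  chunk K r = suc K * (4 * supply K r)

  chunk-def : ∀ K r → chunk K r ≡ suc K * (4 * supply K r)
  chunk-def K r = refl

m<suc[m/n]*n : ∀ m n {{_ : NonZero n}} → m < suc (m / n) * n
m<suc[m/n]*n m n = begin-strict
  m                        ≡⟨ m≡m%n+[m/n]*n m n ⟩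
  m % n + m / n * n        <⟨ +-monoˡ-< (m / n * n) (m%n<n m n) ⟩
  n + m / n * n            ∎
  where open ≤-Reasoning

-- Of `c` useful vertices, `o` lie off the path and `e` are otherwise excluded, so `n` is at least
-- p/2 - s - e. The left side of the conclusion is at most p/4 + s, and the former exceeds the
-- latter once p > 4 (2 s + e).
leftover-large : ∀ s {{_ : NonZero (4 * s)}} {p c o e n} → p ≤ 2 * c → c ≤ n + (o + e) → o ≤ s →
  4 * (2 * s + e) < p → suc (p / (4 * s)) * s < n
leftover-large s {p} {c} {o} {e} {n} p≤ c≤ o≤ big = *-cancelˡ-< 4 _ _ (+-cancelʳ-< (4 * (s + e)) _ _ (begin-strict
  4 * (suc q * s) + 4 * (s + e)       ≡⟨ arith₁ q s e ⟩
  q * (4 * s) + 4 * (2 * s + e)       ≤⟨ +-monoˡ-≤ _ (m/n*n≤m p (4 * s)) ⟩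
  p + 4 * (2 * s + e)                 <⟨ +-monoʳ-< p big ⟩
  p + p                               ≤⟨ +-mono-≤ p≤ p≤ ⟩
  2 * c + 2 * c                       ≡⟨ arith₂ c ⟩
  4 * c                               ≤⟨ *-monoʳ-≤ 4 c≤ ⟩
  4 * (n + (o + e))                   ≤⟨ *-monoʳ-≤ 4 (+-monoʳ-≤ n (+-monoˡ-≤ e o≤)) ⟩
  4 * (n + (s + e))                   ≡⟨ *-distribˡ-+ 4 n (s + e) ⟩
  4 * n + 4 * (s + e)                 ∎))
  where
  open ≤-Reasoning
  q = p / (4 * s)
  arith₁ : ∀ q s e → 4 * (suc q * s) + 4 * (s + e) ≡ q * (4 * s) + 4 * (2 * s + e)
  arith₁ = solve-∀
  arith₂ : ∀ c → 2 * c + 2 * c ≡ 4 * c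
  arith₂ = solve-∀

-- Rerouting a path through a complete bipartite subgraph.

module Detours {V : Set} (_≟_ : DecidableEquality V) (E : Rel V 0ℓ)
               (E? : Decidable₂ E) (E-sym : Symmetric E) where

  open Walks E
  open import Data.List.Membership.DecPropositional _≟_ using (_∈?_)

  -- A path of xs has been cut into two pieces, from x to a and from b to y,
  -- which a zigzag through ms can reconnect with any even length up to 2 r.
  record Detour (x y : V) (Z xs : List V) (r d : ℕ) : Set where
    field
      {a b}     : V
      as bs ms  : List V
      pathˡ     : Path x a as
      pathʳ     : Path b y bs
      unique    : Unique (ms ++ as ++ bs)
      avoids    : Disjoint Z (ms ++ as ++ bs)
      zigzags   : ∀ i → i < r → ∃[ zs ] (Path a b zs × length zs ≡ 2 * suc i × Unique zs × zs ⊆ ms)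
      -- These vertices become the set `Z` that later detours avoid, and the size of `Z` enters the
      -- lower bound on `p`.
      ms-length : length ms ≡ 2 * suc r
      -- The shortest zigzag puts 2 vertices back, so 3 makes the rerouted path strictly shorter.
      shorter   : 3 + (length as + length bs) ≤ length xs
      longer    : length xs ≤ length as + length bs + d

  module _ {r : ℕ} {Z : List V} {x y a b u : V} {us ws : List V} (≥1 : 1 ≤ r) (us-length : length us ≡ r) (ws-length : length ws ≡ suc r)
           (au~ : All (λ u → All (E u) ws) (a ∷ us)) (b~ : All (E b) ws) where

    private
      -- A path's list omits its first vertex, so `b` is absent from the piece that starts at it and
      -- is listed with the zigzag that ends at it.
      ms = ws ++ us ++ [ b ]

      ms-length : length ms ≡ 2 * suc r
      ms-length = begin
        length (ws ++ us ++ [ b ])         ≡⟨ length-++ ws ⟩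
        length ws + length (us ++ [ b ])   ≡⟨ cong₂ _+_ ws-length (trans (length-++ us) (cong (_+ 1) us-length)) ⟩
        suc r + (r + 1)                    ≡⟨ arith r ⟩
        2 * suc r                          ∎
        where
        open ≡-Reasoning
        arith : ∀ r → suc r + (r + 1) ≡ 2 * suc r
        arith = solve-∀

      zigzags : Unique ms → ∀ i → i < r → ∃[ zs ] (Path a b zs × length zs ≡ 2 * suc i × Unique zs × zs ⊆ ms)
      zigzags uq i i<r = zigzag E-sym i ws us (subst (i <_) (sym ws-length) (m≤n⇒m≤1+n i<r))
        (subst (i ≤_) (sym us-length) (<⇒≤ i<r)) au~ b~ uq

      prefix-unique : ∀ {ys} → Unique (ms ++ ys) → Unique ms
      prefix-unique {ys} = unique-⊑ (++⁺ʳ ys ⊆-refl)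

      long : ∀ {ls} → u ∷ us ⊑ ls → 2 ≤ length ls
      long τ = ≤-trans (s≤s (subst (1 ≤_) (sym us-length) ≥1)) (length-mono-≤ τ)

    -- The path is interrupted between `a` and `b`. One side of the zigzag comes from the
    -- interrupted stretch `ls` and the other from outside the path, so the two remaining pieces
    -- stay intact.
    detour-outside : ∀ {d} as ls bs → u ∷ us ⊑ ls → suc (length ls) ≤ d →
      Path x y (as ++ a ∷ ls ++ b ∷ bs) → Unique (as ++ a ∷ ls ++ b ∷ bs) →
      Disjoint Z (as ++ a ∷ ls ++ b ∷ bs) →
      Unique ws → Disjoint ws (as ++ a ∷ ls ++ b ∷ bs) → Disjoint Z ws →
      Detour x y Z (as ++ a ∷ ls ++ b ∷ bs) r d
    detour-outside {d} as ls bs us⊑ ls≤d path uq Z# uw w# Zw = record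
      { as = as ++ [ a ]
      ; bs = bs
      ; ms = ms
      ; pathˡ = proj₁ cut₁
      ; pathʳ = proj₂ cut₂
      ; unique = unique
      ; avoids = λ (z∈Z , z∈) → [ (λ z∈w → Zw (z∈Z , z∈w)) , (λ z∈xs → Z# (z∈Z , ⊑⇒⊆ core⊑ z∈xs)) ]′
                   (∈-++⁻ ws (∈-resp-↭ (↭-sym σ) z∈))
      ; zigzags = zigzags (prefix-unique unique)
      ; ms-length = ms-length
      ; shorter = subst (3 + (length (as ++ [ a ]) + length bs) ≤_) (sym len)
                    (subst (_≤ n + suc (length ls)) (+-comm n 3) (+-monoʳ-≤ n (s≤s (long us⊑))))
      ; longer = subst (_≤ n + d) (sym len) (+-monoʳ-≤ n ls≤d)
      }
      where
      n = length (as ++ [ a ]) + length bs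
      cut₁ = split as path
      cut₂ = split ls (proj₂ cut₁)
      core = as ++ a ∷ us ++ b ∷ bs
      core⊑ : core ⊑ as ++ a ∷ ls ++ b ∷ bs
      core⊑ = ++⁺ (⊆-refl {x = as}) (refl ∷ ++⁺ (⊆-trans (u ∷ʳ ⊆-refl) us⊑) ⊆-refl)
      σ : ws ++ core ↭ ms ++ (as ++ [ a ]) ++ bs
      σ = solve 6 (λ as a us b bs ws → ws ⊕ as ⊕ a ⊕ us ⊕ b ⊕ bs ⊜ (ws ⊕ us ⊕ b) ⊕ (as ⊕ a) ⊕ bs)
            ↭-refl as [ a ] us [ b ] bs ws
        where open CMSolver (++-commutativeMonoid {A = V})
      unique : Unique (ms ++ (as ++ [ a ]) ++ bs)
      unique = unique-↭ σ (Unique.++⁺ uw (unique-⊑ core⊑ uq) λ (z∈w , z∈) → w# (z∈w , ⊑⇒⊆ core⊑ z∈))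
      len : length (as ++ a ∷ ls ++ b ∷ bs) ≡ n + suc (length ls)
      len = begin
        length (as ++ a ∷ ls ++ b ∷ bs)
          ≡⟨ trans (length-++ as) (cong (λ l → length as + suc l) (length-++ ls)) ⟩
        length as + suc (length ls + suc (length bs))
          ≡⟨ arith (length as) (length ls) (length bs) ⟩
        length as + 1 + length bs + suc (length ls)
          ≡⟨ cong (λ l → l + length bs + suc (length ls)) (length-++ as) ⟨
        n + suc (length ls) ∎
        where
        open ≡-Reasoning
        arith : ∀ x y z → x + suc (y + suc z) ≡ x + 1 + z + suc y
        arith = solve-∀

    -- Taking `ws` from `ks` breaks the path a second time, between `v` and `w`. The vertex `u`, set
    -- aside from the first stretch and adjacent to both, bridges this gap.
    detour-inside : ∀ {d v w} as ls bs ks cs → u ∷ us ⊑ ls → ws ⊑ ks → length ls + length ks ≤ d → E u v → E u w →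
      let xs = as ++ a ∷ ls ++ b ∷ bs ++ v ∷ ks ++ w ∷ cs in
      Path x y xs → Unique xs → Disjoint Z xs → Detour x y Z xs r d
    detour-inside {d} {v} {w} as ls bs ks cs us⊑ ws⊑ small uv uw path uq Z# = record
      { as = as ++ [ a ]
      ; bs = bs′
      ; ms = ms
      ; pathˡ = proj₁ cut₁
      ; pathʳ = proj₁ cut₃ ++ᵖ E-sym uv ∷ uw ∷ proj₂ cut₄
      ; unique = unique
      ; avoids = λ (z∈Z , z∈) → Z# (z∈Z , ⊑⇒⊆ core⊑ (∈-resp-↭ (↭-sym σ) z∈))
      ; zigzags = zigzags (prefix-unique unique)
      ; ms-length = ms-length
      ; shorter = subst (3 + n ≤_) (sym len)
                    (subst (_≤ n + (length ls + length ks)) (+-comm n 3)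
                      (+-monoʳ-≤ n (+-mono-≤ (long us⊑) (≤-trans (subst (1 ≤_) (sym ws-length) (s≤s z≤n)) (length-mono-≤ ws⊑)))))
      ; longer = subst (_≤ n + d) (sym len) (+-monoʳ-≤ n small)
      }
      where
      xs = as ++ a ∷ ls ++ b ∷ bs ++ v ∷ ks ++ w ∷ cs
      bs′ = (bs ++ [ v ]) ++ u ∷ w ∷ cs
      n = length (as ++ [ a ]) + length bs′
      cut₁ = split as path
      cut₂ = split ls (proj₂ cut₁)
      cut₃ = split bs (proj₂ cut₂)
      cut₄ = split ks (proj₂ cut₃)
      core = as ++ a ∷ (u ∷ us) ++ b ∷ bs ++ v ∷ ws ++ w ∷ cs
      core⊑ : core ⊑ xs
      core⊑ = ++⁺ (⊆-refl {x = as}) (refl ∷ ++⁺ us⊑ (refl ∷ ++⁺ (⊆-refl {x = bs}) (refl ∷ ++⁺ ws⊑ ⊆-refl)))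
      σ : core ↭ ms ++ (as ++ [ a ]) ++ bs′
      σ = solve 10 (λ as a u us b bs v ws w cs →
              as ⊕ a ⊕ (u ⊕ us) ⊕ b ⊕ bs ⊕ v ⊕ ws ⊕ w ⊕ cs
                ⊜ (ws ⊕ us ⊕ b) ⊕ (as ⊕ a) ⊕ (bs ⊕ v) ⊕ u ⊕ w ⊕ cs)
            ↭-refl as [ a ] [ u ] us [ b ] bs [ v ] ws [ w ] cs
        where open CMSolver (++-commutativeMonoid {A = V})
      unique : Unique (ms ++ (as ++ [ a ]) ++ bs′)
      unique = unique-↭ σ (unique-⊑ core⊑ uq)
      len : length xs ≡ n + (length ls + length ks)
      len = begin
        length xs
          ≡⟨ trans (length-++ as) (cong (λ l → length as + suc l) (trans (length-++ ls)
               (cong (λ l → length ls + suc l) (trans (length-++ bs) (cong (λ l → length bs + suc l) (length-++ ks)))))) ⟩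
        length as + suc (length ls + suc (length bs + suc (length ks + suc (length cs))))
          ≡⟨ arith (length as) (length ls) (length bs) (length ks) (length cs) ⟩
        (length as + 1) + ((length bs + 1) + suc (suc (length cs))) + (length ls + length ks)
          ≡⟨ cong (_+ (length ls + length ks)) (cong₂ _+_ (length-++ as)
               (trans (length-++ (bs ++ [ v ])) (cong (_+ suc (suc (length cs))) (length-++ bs)))) ⟨
        n + (length ls + length ks) ∎
        where
        open ≡-Reasoning
        arith : ∀ x y z k c → x + suc (y + suc (z + suc (k + suc c))) ≡ (x + 1) + ((z + 1) + suc (suc c)) + (y + k)
        arith = solve-∀

  private
    regroup : ∀ (as : List V) {a} ls {b bs rest} → (as ++ a ∷ ls ++ b ∷ bs) ++ rest ≡ as ++ a ∷ ls ++ b ∷ bs ++ rest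
    regroup as ls = trans (++-assoc as _ _) (cong (λ l → as ++ _ ∷ l) (++-assoc ls _ _))

  module _ {S : List V} {p K : ℕ} (uqS : Unique S) (small : length S ≤ suc K * p)
           (deg : All (λ x → p ≤ count (E? x) S) S) where

    private
      module _ (r : ℕ) (≥1 : 1 ≤ r) (Z : List V) where

        d₁ = segment K r
        s  = supply K r
        d₂ = chunk K r
        instance _ = supply≢0 K r

        module Cut {x y : V} {seg rest : List V} (seg-length : length seg ≡ d₁) (big : 4 * (2 * s + (length Z + d₁)) < p)
                 (path : Path x y (seg ++ rest)) (uq : Unique (seg ++ rest)) (⊆S : seg ++ rest ⊆ S)
                 (Z# : Disjoint Z (seg ++ rest)) where

          Good : Pred V 0ℓ
          Good w = suc (2 + r) ≤ count (λ u → E? u w) seg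

          Good? : Decidable Good
          Good? w = suc (2 + r) ≤? count (λ u → E? u w) seg

          Off? : Decidable (λ w → Good w × w ∉ Z × w ∉ seg ++ rest)
          Off? w = Good? w ×-dec ¬? (w ∈? Z) ×-dec ¬? (w ∈? (seg ++ rest))

          enough : ∀ {n} → s ≤ n → suc (2 + r) * 2 ^ length seg ≤ n
          enough s≤ = subst (_≤ _) (trans (supply-def K r) (cong (λ l → suc (2 + r) * 2 ^ l) (sym seg-length))) s≤

          segment-≤ : ∀ {as a ls b bs} → seg ≡ as ++ a ∷ ls ++ b ∷ bs → suc (length ls) ≤ d₁
          segment-≤ {as} {a} {ls} {b} {bs} refl = subst (suc (length ls) ≤_) seg-length
            (length-mono-≤ {as = a ∷ ls} {bs = as ++ a ∷ ls ++ b ∷ bs} (++⁺ˡ as (refl ∷ ++⁺ʳ (b ∷ bs) ⊆-refl)))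

          -- With `3 + r` neighbours in `seg` each, `s` vertices are as many as `complete-bipartite`
          -- demands.
          via-outside : s ≤ count Off? S → Detour x y Z (seg ++ rest) r (d₁ + d₂)
          via-outside s≤
            with complete-bipartite E? (3 + r) (2 + r) seg (filter Off? S)
                   (All.tabulate (λ w∈ → proj₁ (proj₂ (∈-filter⁻ Off? {xs = S} w∈)))) (enough s≤)
          ... | us , v ∷ w ∷ ws , us⊑ , lu , ws⊑ , lw , uw
            with split-ends (suc r) us⊑ lu
          ... | as , a , ls , b , bs , u ∷ us′ , refl , eq , us′⊑ , lu′ =
            subst (λ l → Detour x y Z l r (d₁ + d₂)) (sym full)
              (detour-outside {ws = ws} ≥1 (suc-injective lu′) (suc-injective (suc-injective lw))
                (tails (All.head uw) ∷ All.map tails (All.++⁻ˡ us′ (All.tail (All.tail uw))))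
                (tails (All.head (All.++⁻ʳ us′ (All.tail (All.tail uw)))))
                as ls (bs ++ rest) us′⊑ (≤-trans (segment-≤ {as} eq) (m≤m+n d₁ d₂))
                (subst (Path x y) full path) (subst Unique full uq)
                (λ (z∈ , z∈′) → Z# (z∈ , subst (_ ∈_) (sym full) z∈′))
                (unique-⊑ (⊆-trans (v ∷ʳ w ∷ʳ ⊆-refl) ws⊑) (Unique.filter⁺ Off? uqS))
                (λ (z∈ , z∈′) → proj₂ (proj₂ (off z∈)) (subst (_ ∈_) (sym full) z∈′))
                (λ (z∈Z , z∈) → proj₁ (proj₂ (off z∈)) z∈Z))
            where
            tails : ∀ {u} → All (E u) (v ∷ w ∷ ws) → All (E u) ws
            tails = All.tail ∘ All.tail
            off : ∀ {z} → z ∈ ws → _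
            off z∈ = proj₂ (∈-filter⁻ Off? {xs = S} (⊑⇒⊆ ws⊑ (there (there z∈))))
            full : seg ++ rest ≡ as ++ a ∷ ls ++ b ∷ bs ++ rest
            full = trans (cong (_++ rest) eq) (regroup as ls)

          -- At least p/2 vertices of `S` are good. Few of them lie off the path, in `Z` or in
          -- `seg`, so `rest` has many. It is covered by `suc (p / (4 * s))` chunks of length `d₂`,
          -- since a path in `S` has at most `suc K * p` vertices; some chunk therefore contains `s`
          -- good ones.
          via-inside : count Off? S ≤ s → Detour x y Z (seg ++ rest) r (d₁ + d₂)
          via-inside ≤s
            with dense-chunk Good? d₂ s (suc (p / (4 * s))) rest rest≤
                   (leftover-large s (many-neighbours E? p K (2 + r) seg S seg-degrees (trans seg-length (segment-def K r)) small)
                     good-split ≤s big)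
            where
            seg-degrees : All (λ u → p ≤ count (E? u) S) seg
            seg-degrees = All.tabulate (λ u∈ → All.lookup deg (⊆S (∈-++⁺ˡ u∈)))

            good-split : count Good? S ≤ count Good? rest + (count Off? S + (length Z + d₁))
            good-split = begin
              count Good? S
                ≤⟨ count-split Good? Good? rest (filter Off? S ++ Z ++ seg) uqS place ⟩
              count Good? rest + length (filter Off? S ++ Z ++ seg)
                ≡⟨ cong (count Good? rest +_) (trans (length-++ (filter Off? S))
                     (cong (count Off? S +_) (trans (length-++ Z) (cong (length Z +_) seg-length)))) ⟩
              count Good? rest + (count Off? S + (length Z + d₁)) ∎
              where
              open ≤-Reasoning
              place : ∀ {w} → w ∈ S → Good w → (w ∈ rest × Good w) ⊎ w ∈ filter Off? S ++ Z ++ seg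
              place {w} w∈S good with w ∈? Z | w ∈? (seg ++ rest)
              ... | yes w∈Z | _       = inj₂ (∈-++⁺ʳ (filter Off? S) (∈-++⁺ˡ w∈Z))
              ... | no  w∉Z | no  w∉  = inj₂ (∈-++⁺ˡ (∈-filter⁺ Off? w∈S (good , w∉Z , w∉)))
              ... | no  w∉Z | yes w∈  with ∈-++⁻ seg w∈
              ...   | inj₁ w∈seg  = inj₂ (∈-++⁺ʳ (filter Off? S) (∈-++⁺ʳ Z w∈seg))
              ...   | inj₂ w∈rest = inj₁ (w∈rest , good)

            rest≤ : length rest ≤ suc (p / (4 * s)) * d₂
            rest≤ = begin
              length rest                            ≤⟨ length-mono-≤ (++⁺ˡ seg (⊆-refl {x = rest})) ⟩
              length (seg ++ rest)                   ≤⟨ unique-length-≤ uq ⊆S ⟩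
              length S                               ≤⟨ small ⟩
              suc K * p                              ≤⟨ *-monoʳ-≤ (suc K) (<⇒≤ (m<suc[m/n]*n p (4 * s))) ⟩
              suc K * (suc (p / (4 * s)) * (4 * s))  ≡⟨ arith (suc K) (suc (p / (4 * s))) (4 * s) ⟩
              suc (p / (4 * s)) * (suc K * (4 * s))  ≡⟨ cong (suc (p / (4 * s)) *_) (chunk-def K r) ⟨
              suc (p / (4 * s)) * d₂                 ∎
              where
              open ≤-Reasoning
              arith : ∀ x y z → x * (y * z) ≡ y * (x * z)
              arith = solve-∀
          ... | c₁ , B , c₂ , rest≡ , B≤ , good≥
            with complete-bipartite E? (3 + r) (2 + r) seg (filter Good? B)
                   (All.tabulate (λ w∈ → proj₂ (∈-filter⁻ Good? {xs = B} w∈))) (enough good≥)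
          ... | us , vs , us⊑ , lu , vs⊑ , lv , uv
            with split-ends (suc r) us⊑ lu | split-ends (suc r) (⊆-trans vs⊑ (filter-⊆ Good? B)) lv
          -- This is why both sides have `3 + r` vertices: one consists of `a`, `u`, the `r`
          -- vertices of `us′` and `b`, the other of `v`, the `r + 1` vertices of `ws` and `w`.
          ... | as , a , ls , b , bs , u ∷ us′ , refl , eq , us′⊑ , lu′
              | k₁ , v , ks , w , k₂ , ws , refl , B≡ , ws⊑ , lw =
            subst (λ l → Detour x y Z l r (d₁ + d₂)) (sym full)
              (detour-inside {ws = ws} ≥1 (suc-injective lu′) lw
                (mids (All.head uv) ∷ All.map mids (All.++⁻ˡ us′ (All.tail (All.tail uv))))
                (mids (All.head (All.++⁻ʳ us′ (All.tail (All.tail uv)))))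
                as ls (bs ++ c₁ ++ k₁) ks (k₂ ++ c₂) us′⊑ ws⊑
                (+-mono-≤ (<⇒≤ (segment-≤ {as} eq)) ks≤)
                (All.head u~) (All.head (All.++⁻ʳ ws (All.tail u~)))
                (subst (Path x y) full path) (subst Unique full uq)
                (λ (z∈ , z∈′) → Z# (z∈ , subst (_ ∈_) (sym full) z∈′)))
            where
            mids : ∀ {u} → All (E u) (v ∷ ws ++ [ w ]) → All (E u) ws
            mids = All.++⁻ˡ ws ∘ All.tail
            u~ : All (E u) (v ∷ ws ++ [ w ])
            u~ = All.head (All.tail uv)
            ks≤ : length ks ≤ d₂
            ks≤ = ≤-trans (length-mono-≤ (++⁺ˡ k₁ (v ∷ʳ ++⁺ʳ (w ∷ k₂) (⊆-refl {x = ks}))))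
                    (subst (λ l → length l ≤ d₂) B≡ B≤)
            full : seg ++ rest ≡ as ++ a ∷ ls ++ b ∷ (bs ++ c₁ ++ k₁) ++ v ∷ ks ++ w ∷ k₂ ++ c₂
            full = begin
              seg ++ rest
                ≡⟨ trans (cong (_++ rest) eq) (regroup as ls) ⟩
              as ++ a ∷ ls ++ b ∷ bs ++ rest
                ≡⟨ cong (λ l → as ++ a ∷ ls ++ b ∷ bs ++ l) (trans rest≡ (cong (λ B → c₁ ++ B ++ c₂) B≡)) ⟩
              as ++ a ∷ ls ++ b ∷ bs ++ c₁ ++ (k₁ ++ v ∷ ks ++ w ∷ k₂) ++ c₂
                ≡⟨ cong (λ l → as ++ a ∷ ls ++ b ∷ bs ++ c₁ ++ l) (regroup k₁ ks) ⟩
              as ++ a ∷ ls ++ b ∷ bs ++ c₁ ++ k₁ ++ v ∷ ks ++ w ∷ k₂ ++ c₂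
                ≡⟨ cong (λ l → as ++ a ∷ ls ++ b ∷ l) (trans (++-assoc bs (c₁ ++ k₁) _) (cong (bs ++_) (++-assoc c₁ k₁ _))) ⟨
              as ++ a ∷ ls ++ b ∷ (bs ++ c₁ ++ k₁) ++ v ∷ ks ++ w ∷ k₂ ++ c₂ ∎
              where open ≡-Reasoning

    detour : ∀ r → 1 ≤ r → ∀ Z {x y xs} → segment K r ≤ length xs →
      4 * (2 * supply K r + (length Z + segment K r)) < p →
      Path x y xs → Unique xs → xs ⊆ S → Disjoint Z xs → Detour x y Z xs r (segment K r + chunk K r)
    detour r ≥1 Z {x} {y} {xs} long big path uq ⊆S Z# =
      subst (λ l → Detour x y Z l r (segment K r + chunk K r)) whole result
      where
      seg = take (segment K r) xs
      rest = drop (segment K r) xs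
      whole : seg ++ rest ≡ xs
      whole = take++drop≡id (segment K r) xs
      seg-length : length seg ≡ segment K r
      seg-length = trans (length-take (segment K r) xs) (m≤n⇒m⊓n≡m long)
      module D = Cut r ≥1 Z {x} {y} {seg} {rest} seg-length big (subst (Path x y) (sym whole) path) (subst Unique (sym whole) uq)
                   (λ z∈ → ⊆S (subst (_ ∈_) whole z∈)) (λ (z∈ , z∈′) → Z# (z∈ , subst (_ ∈_) whole z∈′))
      result : Detour x y Z (seg ++ rest) r (segment K r + chunk K r)
      result with supply K r ≤? count D.Off? S
      ... | yes s≤ = D.via-outside s≤
      ... | no  s≰ = D.via-inside (≰⇒≥ s≰)

-- Aligned elements of alternating lists.

slots : Bool → ℕ → ℕ
slots _     zero    = 0
slots true  (suc m) = suc (slots false m)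
slots false (suc m) = slots true m

slots-even : ∀ q → slots true (2 * q) ≡ q
slots-even zero = refl
slots-even (suc q) rewrite +-suc q (q + 0) = cong suc (slots-even q)

module _ {A : Set} {P : Pred A 0ℓ} where

  -- Lists all of whose P-elements are at even positions (true) or odd positions (false).
  data Alternating : Bool → List A → Set where
    []   : ∀ {b} → Alternating b []
    _∷ᵗ_ : ∀ x {xs} → Alternating false xs → Alternating true (x ∷ xs)
    _∷ᶠ_ : ∀ {x xs} → ¬ P x → Alternating true xs → Alternating false (x ∷ xs)

  alternating-drop : ∀ q {b xs} → Alternating b xs → Alternating b (drop (2 * q) xs)
  alternating-drop zero    alt = alt
  alternating-drop (suc q) alt rewrite +-suc q (q + 0) = go alt
    where
    go : ∀ {b xs} → Alternating b xs → Alternating b (drop (suc (suc (q + (q + 0)))) xs)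
    go []                 = []
    go (x ∷ᵗ [])          = []
    go (x ∷ᵗ (¬p ∷ᶠ alt)) = alternating-drop q alt
    go (¬p ∷ᶠ [])         = []
    go (¬p ∷ᶠ (x ∷ᵗ alt)) = alternating-drop q alt

  alternating-take : ∀ m {b xs} → Alternating b xs → Alternating b (take m xs)
  alternating-take zero    alt        = []
  alternating-take (suc m) []         = []
  alternating-take (suc m) (x ∷ᵗ alt) = x ∷ᵗ alternating-take m alt
  alternating-take (suc m) (p ∷ᶠ alt) = p ∷ᶠ alternating-take m alt

  module _ (P? : Decidable P) where

    Aligned : List A → List A → Set
    Aligned xs ys = ∃[ xs₁ ] ∃[ x ] ∃[ xs₂ ] ∃[ ys₁ ] ∃[ y ] ∃[ ys₂ ]
      (xs ≡ xs₁ ++ x ∷ xs₂ × ys ≡ ys₁ ++ y ∷ ys₂ × length xs₁ ≡ length ys₁ × P x × P y)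

    private
      later : ∀ {x y xs ys} → Aligned xs ys → Aligned (x ∷ xs) (y ∷ ys)
      later (xs₁ , _ , _ , ys₁ , _ , _ , refl , refl , len , px , py) =
        _ ∷ xs₁ , _ , _ , _ ∷ ys₁ , _ , _ , refl , refl , cong suc len , px , py

      no-[] : ∀ {xs} {B : Set} → Aligned xs [] → B
      no-[] (_ , _ , _ , [] , _ , _ , _ , () , _)
      no-[] (_ , _ , _ , _ ∷ _ , _ , _ , _ , () , _)

    -- Pigeonhole: `slots b m` counts those of the first `m` positions that are open to P-elements,
    -- and as long as no position is occupied in both lists, every P-element uses up a slot of its
    -- own.
    aligned : ∀ m {b xs ys} → Alternating b xs → Alternating b ys → length xs ≤ m → length ys ≤ length xs →
      slots b m < count P? xs + count P? ys → Aligned xs ys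
    aligned m [] [] _ _ ()
    aligned (suc m) {true} {x ∷ xs} (_ ∷ᵗ alt) [] (s≤s ≤m) _ lt with P? x
    ... | yes _ = no-[] (aligned m alt [] ≤m z≤n (s≤s⁻¹ lt))
    ... | no  _ = no-[] (aligned m alt [] ≤m z≤n (<⇒≤ lt))
    aligned (suc m) {true} {x ∷ xs} {y ∷ ys} (_ ∷ᵗ alt) (_ ∷ᵗ alt′) (s≤s ≤m) (s≤s ≤l) lt with P? x | P? y
    ... | yes px | yes py = [] , x , xs , [] , y , ys , refl , refl , refl , px , py
    ... | yes _  | no  _  = later (aligned m alt alt′ ≤m ≤l (s≤s⁻¹ lt))
    ... | no  _  | yes _  = later (aligned m alt alt′ ≤m ≤l (s≤s⁻¹ (subst (suc (slots false m) <_) (+-suc _ _) lt)))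
    ... | no  _  | no  _  = later (aligned m alt alt′ ≤m ≤l (<⇒≤ lt))
    aligned (suc m) {false} {x ∷ xs} (¬px ∷ᶠ alt) [] (s≤s ≤m) _ lt
      rewrite filter-reject P? {xs = xs} ¬px = no-[] (aligned m alt [] ≤m z≤n lt)
    aligned (suc m) {false} {x ∷ xs} {y ∷ ys} (¬px ∷ᶠ alt) (¬py ∷ᶠ alt′) (s≤s ≤m) (s≤s ≤l) lt
      rewrite filter-reject P? {xs = xs} ¬px | filter-reject P? {xs = ys} ¬py =
      later (aligned m alt alt′ ≤m ≤l lt)

take-full : ∀ {A : Set} n {xs : List A} {y} → y ∈ drop n xs → length (take n xs) ≡ n
take-full zero    _                = refl
take-full (suc n) {_ ∷ _} y∈       = cong suc (take-full n y∈)

half-< : ∀ {l h p} → l ≡ 2 * h → 2 + l ≤ 2 * p → h < p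
half-< {h = h} {p} refl le = *-cancelˡ-≤ 2 (subst (_≤ 2 * p) (sym (*-suc 2 h)) le)

-- Even cycles in bipartite graphs.

coarse : ℕ → ℕ
coarse K = segment K 1 + chunk K 1

-- Chosen above the largest loss in a detour with parameter 1, so that one such shortening cannot
-- overshoot the range in which the large zigzag adjusts the length.
reach : ℕ → ℕ
reach K = suc (coarse K)

-- The summands are the demand of the first detour, with nothing to avoid; the demand of the later
-- ones, which avoid the `2 * suc (reach K)` vertices reserved by the first; and the largest loss in
-- the first detour.
threshold : ℕ → ℕ
threshold K = 4 * (2 * supply K (reach K) + segment K (reach K))
            + (4 * (2 * supply K 1 + (2 * suc (reach K) + segment K 1))
            + (segment K (reach K) + chunk K (reach K)))

module BipartiteGraph {V : Set} (_≟_ : DecidableEquality V) (E : Rel V 0ℓ)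
                      (E? : Decidable₂ E) (E-sym : Symmetric E)
                      (col : V → Bool) (E-col : ∀ {x y} → E x y → col y ≡ not (col x)) where

  open Walks E
  open Detours _≟_ E E? E-sym
  open import Data.List.Membership.DecPropositional _≟_ using (_∈?_)

  path-parity : ∀ {x y xs} → Path x y xs →
    (col x ≡ col y × ∃[ h ] length xs ≡ 2 * h) ⊎ (col x ≢ col y × ∃[ h ] length xs ≡ suc (2 * h))
  path-parity [] = inj₁ (refl , 0 , refl)
  path-parity (e ∷ p) with path-parity p
  ... | inj₁ (eq , h , len) = inj₂ ((λ eq′ → not-¬ refl (trans eq′ (trans (sym eq) (E-col e)))) , h , cong suc len)
  ... | inj₂ (ne , h , len) = inj₁
    ( trans (sym (not-involutive _)) (sym (¬-not λ eq → ne (trans (E-col e) (sym eq))))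
    , suc h , trans (cong suc len) (sym (*-suc 2 h)))

  mutual
    -- Colours alternate along the path, and all neighbours of `x₀` have the colour opposite to its
    -- own.
    alternating-even : ∀ {x₀ x z xs} → col x ≡ col x₀ → Path x z xs → Alternating {P = E x₀} true xs
    alternating-even eq []      = []
    alternating-even eq (e ∷ p) = _ ∷ᵗ alternating-odd (trans (E-col e) (cong not eq)) p

    alternating-odd : ∀ {x₀ x z xs} → col x ≡ not (col x₀) → Path x z xs → Alternating {P = E x₀} false xs
    alternating-odd eq []      = []
    alternating-odd eq (e ∷ p) = (λ e₀ → not-¬ refl (trans (sym same) (E-col e₀))) ∷ᶠ alternating-even same p
      where same = trans (E-col e) (trans (cong not eq) (not-involutive _))

  module _ {S : List V} {p K : ℕ} (uqS : Unique S) (small : length S ≤ suc K * p)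
           (deg : All (λ x → p ≤ count (E? x) S) S) (E-S : ∀ {x y} → E x y → y ∈ S) where

    path-⊆ : ∀ {x y xs} → Path x y xs → xs ⊆ S
    path-⊆ (e ∷ _) (here refl) = E-S e
    path-⊆ (_ ∷ p) (there z∈)  = path-⊆ p z∈

    -- Neighbours are prepended while the start has one off the path. The fuel `f` suffices because
    -- a duplicate-free path in `S` cannot outgrow `S`.
    maximal-path : ∀ f {x z xs} → Path x z xs → Unique (x ∷ xs) → x ∈ S → length S < suc (length xs) + f →
      ∃[ x′ ] ∃[ xs′ ] (Path x′ z xs′ × Unique (x′ ∷ xs′) × x′ ∈ S × (∀ {y} → E x′ y → y ∈ xs′))
    maximal-path f {x} {z} {xs} path uq x∈ lt with any? (λ y → E? x y ×-dec ¬? (y ∈? (x ∷ xs))) S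
    ... | no none = x , xs , path , uq , x∈ , stays
      where
      stays : ∀ {y} → E x y → y ∈ xs
      stays {y} e with y ∈? (x ∷ xs)
      ... | no y∉            = contradiction (lose (E-S e) (e , y∉)) none
      ... | yes (here refl)  = contradiction (E-col e) (not-¬ refl)
      ... | yes (there y∈)   = y∈
    ... | yes found with find found
    maximal-path zero {x} {z} {xs} path uq x∈ lt | yes _ | y , y∈ , e , y∉ =
      contradiction (unique-length-≤ uq λ { (here refl) → x∈ ; (there z∈) → path-⊆ path z∈ })
        (<⇒≱ (subst (length S <_) (+-identityʳ _) lt))
    maximal-path (suc f) {x} {z} {xs} path uq x∈ lt | yes _ | y , y∈ , e , y∉ =
      maximal-path f (E-sym e ∷ path) (All.tabulate (λ { z∈ refl → y∉ z∈ }) ∷ uq) y∈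
        (subst (length S <_) (+-suc (suc (length xs)) f) lt)

    exact-or-long : ∀ q → p ≡ suc q → ∀ {x₀} → x₀ ∈ S →
      Cycle (2 * p) ⊎ ∃[ x ] ∃[ xs ] (Path x x xs × Unique xs × 2 * q + 2 * q + 2 ≤ length xs)
    exact-or-long q refl {x₀} x₀∈ with maximal-path (length S) [] ([] ∷ []) x₀∈ ≤-refl
    ... | x , xs , path , x≢ ∷ uq , x∈ , stays = dichotomy
      where
      n = 2 * q
      -- `A` covers the positions 1 to 2p - 2 after `x`, and `B` the positions 2p - 1 to 4p - 4, as
      -- far as the path reaches; a neighbour of `x` in `C` closes a long cycle.
      A = take n xs
      B = take n (drop n xs)
      C = drop n (drop n xs)

      whole : xs ≡ A ++ B ++ C
      whole = sym (trans (cong (A ++_) (take++drop≡id n (drop n xs))) (take++drop≡id n xs))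

      closed : ∀ {ys} → ys ⊑ xs → Unique (ys ++ [ x ])
      closed τ = unique-swap [ x ] (unique-⊑ (refl ∷ τ) (x≢ ∷ uq))

      long : ∀ {y} → y ∈ C → E x y → ∃[ x ] ∃[ xs ] (Path x x xs × Unique xs × n + n + 2 ≤ length xs)
      long {y} y∈ xy with ∈-∃++ y∈
      ... | as , bs , eq =
        x , (F ++ [ y ]) ++ [ x ] ,
        proj₁ (split F (subst (Path _ _) parts path)) ++ᵖ E-sym xy ∷ [] ,
        closed (subst (F ++ [ y ] ⊑_) (sym parts) (++⁺ (⊆-refl {x = F}) (refl ∷ minimum bs))) , len
        where
        F = A ++ B ++ as
        parts : xs ≡ F ++ y ∷ bs
        parts = trans whole (trans (cong (λ C → A ++ B ++ C) eq)
                  (sym (trans (++-assoc A (B ++ as) _) (cong (A ++_) (++-assoc B as _)))))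
        len : n + n + 2 ≤ length ((F ++ [ y ]) ++ [ x ])
        len = begin
          n + n + 2                                ≤⟨ +-monoˡ-≤ 2 (+-monoʳ-≤ n (m≤m+n n (length as))) ⟩
          n + (n + length as) + 2                  ≡⟨ cong (_+ 2) (cong₂ _+_ (sym (take-full n (⊑⇒⊆ (drop-⊆ n _) y∈)))
                                                       (cong (_+ length as) (sym (take-full n y∈)))) ⟩
          length A + (length B + length as) + 2    ≡⟨ cong (_+ 2) (trans (length-++ A) (cong (length A +_) (length-++ B))) ⟨
          length F + 2                             ≡⟨ +-assoc (length F) 1 1 ⟨
          length F + 1 + 1                         ≡⟨ trans (length-++ (F ++ [ y ])) (cong (_+ 1) (length-++ F)) ⟨
          length ((F ++ [ y ]) ++ [ x ])           ∎
          where open ≤-Reasoning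

      -- All of the at least q + 1 neighbours of `x` lie in `A` and `B`, where only `q` positions
      -- are open to them. Two neighbours thus have the same position in `A` and in `B`; they are 2q
      -- apart on the path, and passing through `x` adds 2.
      exact : ¬ (Any (E x) C) → Cycle (2 * suc q)
      exact none
        with aligned {P = E x} (E? x) n (alternating-take {P = E x} n alt) (alternating-take {P = E x} n (alternating-drop {P = E x} q alt))
               (subst (_≤ n) (sym (length-take n xs)) (m⊓n≤m n _))
               (subst (λ l → length B ≤ l) (sym (length-take n xs))
                 (subst (_≤ n ⊓ length xs) (sym (trans (length-take n (drop n xs)) (cong (n ⊓_) (length-drop n xs))))
                   (⊓-monoʳ-≤ n (m∸n≤m (length xs) n))))
               many
        where
        alt : Alternating {P = E x} true xs
        alt = alternating-even refl path
        many : slots true n < count (E? x) A + count (E? x) B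
        many = begin-strict
          slots true n                                              ≡⟨ slots-even q ⟩
          q                                                         <⟨ ≤-refl ⟩
          suc q                                                     ≤⟨ All.lookup deg x∈ ⟩
          count (E? x) S                                            ≤⟨ count-split (E? x) (E? x) xs [] uqS (λ _ e → inj₁ (stays e , e)) ⟩
          count (E? x) xs + 0                                       ≡⟨ +-identityʳ _ ⟩
          count (E? x) xs                                           ≡⟨ cong (count (E? x)) whole ⟩
          count (E? x) (A ++ B ++ C)                                ≡⟨ count-++ (E? x) A ⟩
          count (E? x) A + count (E? x) (B ++ C)                    ≡⟨ cong (count (E? x) A +_) (count-++ (E? x) B) ⟩
          count (E? x) A + (count (E? x) B + count (E? x) C)        ≡⟨ cong (λ l → count (E? x) A + (count (E? x) B + length l)) (filter-none (E? x) (All.¬Any⇒All¬ C none)) ⟩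
          count (E? x) A + (count (E? x) B + 0)                     ≡⟨ cong (count (E? x) A +_) (+-identityʳ _) ⟩
          count (E? x) A + count (E? x) B                           ∎
          where open ≤-Reasoning
      ... | a₁ , u , a₂ , b₁ , w , b₂ , A≡ , B≡ , a₁~b₁ , xu , xw =
        x , (u ∷ M ++ [ w ]) ++ [ x ] ,
        (xu ∷ proj₁ (split M (proj₂ (split a₁ (subst (Path _ _) parts path))))) ++ᵖ E-sym xw ∷ [] ,
        closed (subst (u ∷ M ++ [ w ] ⊑_) (sym parts)
          (++⁺ˡ a₁ (refl ∷ ++⁺ (⊆-refl {x = M}) (refl ∷ minimum (b₂ ++ C))))) , len
        where
        M = a₂ ++ b₁
        parts : xs ≡ a₁ ++ u ∷ M ++ w ∷ b₂ ++ C
        parts = trans whole (trans (cong₂ (λ A B → A ++ B ++ C) A≡ B≡)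
                  (trans (++-assoc a₁ _ _) (cong (λ l → a₁ ++ u ∷ l)
                    (trans (cong (a₂ ++_) (++-assoc b₁ _ C)) (sym (++-assoc a₂ b₁ _))))))
        A-full : length a₁ + suc (length a₂) ≡ n
        A-full = trans (sym (length-++ a₁)) (trans (cong length (sym A≡))
                   (take-full n (⊑⇒⊆ (take-⊆ n (drop n xs)) (subst (w ∈_) (sym B≡) (∈-insert b₁)))))
        len : length ((u ∷ M ++ [ w ]) ++ [ x ]) ≡ 2 * suc q
        len = begin
          length ((u ∷ M ++ [ w ]) ++ [ x ])         ≡⟨ length-++ (u ∷ M ++ [ w ]) ⟩
          suc (length (M ++ [ w ]) + 1)              ≡⟨ cong (λ l → suc (l + 1)) (trans (length-++ M) (cong (_+ 1) (length-++ a₂))) ⟩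
          suc (length a₂ + length b₁ + 1 + 1)        ≡⟨ cong (λ l → suc (length a₂ + l + 1 + 1)) (sym a₁~b₁) ⟩
          suc (length a₂ + length a₁ + 1 + 1)        ≡⟨ arith (length a₂) (length a₁) ⟩
          2 + (length a₁ + suc (length a₂))          ≡⟨ cong (2 +_) A-full ⟩
          2 + n                                      ≡⟨ *-suc 2 q ⟨
          2 * suc q                                  ∎
          where
          open ≡-Reasoning
          arith : ∀ a b → suc (a + b + 1 + 1) ≡ 2 + (b + suc a)
          arith = solve-∀

      dichotomy : Cycle (2 * suc q) ⊎ ∃[ x ] ∃[ xs ] (Path x x xs × Unique xs × n + n + 2 ≤ length xs)
      dichotomy with any? (E? x) C
      ... | no none = inj₁ (exact none)
      ... | yes far with find far
      ...   | y , y∈ , xy = inj₂ (long y∈ xy)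

    unique-splice : ∀ {zs ms : List V} as {bs} → Unique (ms ++ as ++ bs) → Unique zs → zs ⊆ ms → Unique (as ++ zs ++ bs)
    unique-splice {zs} {ms} as {bs} uq uz zs⊆ = unique-↭ (shifts zs as)
      (Unique.++⁺ uz (unique-⊑ (++⁺ˡ ms ⊆-refl) uq) λ (z∈ , z∈′) → unique-++⁻-disjoint ms uq (zs⊆ z∈ , z∈′))

    module _ (big : threshold K < p) where

      private
        r = reach K

        big₁ : 4 * (2 * supply K r + (0 + segment K r)) < p
        big₁ = ≤-<-trans (m≤m+n _ _) big

        big₂ : ∀ {m} → m ≡ 2 * suc r → 4 * (2 * supply K 1 + (m + segment K 1)) < p
        big₂ refl = ≤-<-trans (≤-trans (m≤m+n _ _) (m≤n+m _ (4 * (2 * supply K r + segment K r)))) big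

        big₃ : segment K r + chunk K r < p
        big₃ = ≤-<-trans (≤-trans (m≤n+m _ (4 * (2 * supply K 1 + (2 * suc r + segment K 1))))
                                  (m≤n+m _ (4 * (2 * supply K r + segment K r)))) big

        segment≤ : segment K 1 ≤ p
        segment≤ = ≤-trans (≤-trans (m≤n+m _ (2 * suc r)) (≤-trans (m≤n+m _ (2 * supply K 1)) (m≤n*m _ 4)))
          (<⇒≤ (big₂ {2 * suc r} refl))

      -- A detour with the shortest zigzag put back makes the path strictly shorter, but by less
      -- than `coarse K`. A path that is still too long has length at least 2p - 1, so one round
      -- cannot take it below 2p - 2r. Avoiding `ms` keeps the large zigzag available.
      reduce : ∀ f {a b ms cs} → length ms ≡ 2 * suc r → length cs ≤ f → 2 * p ≤ length cs + 2 * r →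
        Path b a cs → Unique cs → Disjoint ms cs →
        ∃[ cs ] (Path b a cs × Unique cs × Disjoint ms cs × 2 * p ≤ length cs + 2 * r × 2 + length cs ≤ 2 * p)
      reduce f {ms = ms} {cs} lm ≤f ≥2p path uq ms# with 2 + length cs ≤? 2 * p
      ... | yes ≤2p = cs , path , uq , ms# , ≥2p , ≤2p
      -- The empty path is never too long, because `p` is positive.
      reduce zero    {cs = []} lm z≤n ≥2p path uq ms# | no ≰2p =
        contradiction (≤-trans (*-monoʳ-≤ 2 (≤-trans (s≤s z≤n) big)) ≤-refl) ≰2p
      reduce (suc f) {a} {b} {ms} {cs} lm ≤f ≥2p path uq ms# | no ≰2p =
        reduce f {ms = ms} lm (s≤s⁻¹ (≤-trans (subst (_≤ length cs) (cong suc (sym len)) D.shorter) ≤f)) ≥2p′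
          (D.pathˡ ++ᵖ zpath ++ᵖ D.pathʳ)
          (unique-splice {ms = D.ms} D.as D.unique uz zs⊆)
          (λ (z∈ms , z∈) → D.avoids (z∈ms , widen z∈))
        where
        2p≤ : 2 * p ≤ suc (length cs)
        2p≤ = s≤s⁻¹ (≰⇒> ≰2p)
        module D = Detour (detour uqS small deg 1 ≤-refl ms
          (≤-trans segment≤ (s≤s⁻¹ (≤-trans (≤-trans (subst (_≤ p + p) (+-comm p 1) (+-monoʳ-≤ p (≤-trans (s≤s z≤n) big)))
            (≤-reflexive (cong (p +_) (sym (+-identityʳ p))))) 2p≤)))
          (big₂ lm) path uq (path-⊆ path) ms#)
        zig = D.zigzags 0 ≤-refl
        zs = proj₁ zig
        zpath = proj₁ (proj₂ zig)
        zlen = proj₁ (proj₂ (proj₂ zig))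
        uz = proj₁ (proj₂ (proj₂ (proj₂ zig)))
        zs⊆ = proj₂ (proj₂ (proj₂ (proj₂ zig)))
        len : length (D.as ++ zs ++ D.bs) ≡ 2 + (length D.as + length D.bs)
        len = trans (length-++ D.as) (trans (cong (length D.as +_) (trans (length-++ zs) (cong (_+ length D.bs) zlen)))
                (+-swapˡ (length D.as) 2 (length D.bs)))
        widen : D.as ++ zs ++ D.bs ⊆ D.ms ++ D.as ++ D.bs
        widen z∈ with ∈-++⁻ D.as z∈
        ... | inj₁ z∈as = ∈-++⁺ʳ D.ms (∈-++⁺ˡ z∈as)
        ... | inj₂ z∈′ with ∈-++⁻ zs z∈′
        ...   | inj₁ z∈zs = ∈-++⁺ˡ (zs⊆ z∈zs)
        ...   | inj₂ z∈bs = ∈-++⁺ʳ D.ms (∈-++⁺ʳ D.as z∈bs)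
        ≥2p′ : 2 * p ≤ length (D.as ++ zs ++ D.bs) + 2 * r
        ≥2p′ = begin
          2 * p                                              ≤⟨ 2p≤ ⟩
          suc (length cs)                                    ≤⟨ s≤s D.longer ⟩
          suc (length D.as + length D.bs + coarse K)         ≤⟨ s≤s (+-monoʳ-≤ (length D.as + length D.bs) (≤-trans (n≤1+n _) (m≤n*m r 2))) ⟩
          suc (length D.as + length D.bs + 2 * r)            ≤⟨ n≤1+n _ ⟩
          2 + (length D.as + length D.bs) + 2 * r            ≡⟨ cong (_+ 2 * r) len ⟨
          length (D.as ++ zs ++ D.bs) + 2 * r                ∎
          where open ≤-Reasoning

      close-up : ∀ {a b ms cs} → (∀ i → i < r → ∃[ zs ] (Path a b zs × length zs ≡ 2 * suc i × Unique zs × zs ⊆ ms)) →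
        Path b a cs → Unique cs → Disjoint ms cs → 2 * p ≤ length cs + 2 * r → 2 + length cs ≤ 2 * p → Cycle (2 * p)
      close-up {a} {b} {ms} {cs} zigzags path uq ms# ≥2p ≤2p with even
        where
        even : ∃[ h ] length cs ≡ 2 * h
        even with zigzags 0 (s≤s z≤n)
        -- A zigzag joins the same ends in 2 steps, so `a` and `b` have the same colour and every
        -- path between them has even length.
        ... | _ , zpath , zlen , _ with path-parity path | path-parity zpath
        ...   | inj₁ (_ , h , len) | _                  = h , len
        ...   | inj₂ (ne , _)      | inj₁ (eq , _)      = contradiction (sym eq) ne
        ...   | inj₂ _             | inj₂ (_ , h , len) = contradiction (trans (sym zlen) len) (even≢odd 1 h)
      -- The path contributes 2h to the cycle, so the zigzag must contribute 2 (p - h), which is its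
      -- length for this index.
      ... | h , len with zigzags (p ∸ suc h) i<r
        where
        i<r : p ∸ suc h < r
        i<r = +-cancelˡ-< (suc h) _ _ (begin-strict
          suc h + (p ∸ suc h)    ≡⟨ m+[n∸m]≡n (half-< len ≤2p) ⟩
          p                      ≤⟨ *-cancelˡ-≤ 2 (subst (2 * p ≤_) (trans (cong (_+ 2 * r) len) (sym (*-distribˡ-+ 2 h r))) ≥2p) ⟩
          h + r                  <⟨ ≤-refl ⟩
          suc h + r              ∎)
          where open ≤-Reasoning
      ... | zs , zpath , zlen , uz , zs⊆ =
        b , cs ++ zs , path ++ᵖ zpath , Unique.++⁺ uq uz (λ (z∈cs , z∈zs) → ms# (zs⊆ z∈zs , z∈cs)) , (begin
          length (cs ++ zs)                 ≡⟨ trans (length-++ cs) (cong₂ _+_ len zlen) ⟩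
          2 * h + 2 * suc (p ∸ suc h)       ≡⟨ *-distribˡ-+ 2 h _ ⟨
          2 * (h + suc (p ∸ suc h))         ≡⟨ cong (2 *_) (+-suc h _) ⟩
          2 * (suc h + (p ∸ suc h))         ≡⟨ cong (2 *_) (m+[n∸m]≡n (half-< {h = h} {p} len ≤2p)) ⟩
          2 * p                             ∎)
        where open ≡-Reasoning

      even-cycle : ∀ {x₀} → x₀ ∈ S → Cycle (2 * p)
      even-cycle x₀∈ with exact-or-long (p ∸ 1) (sym (m+[n∸m]≡n (≤-trans (s≤s z≤n) big))) x₀∈
      ... | inj₁ cycle = cycle
      ... | inj₂ (x , xs , path , uq , long) =
        -- The two pieces of the long cycle meet at `x`; read from `b` through `x` to `a`, they form
        -- the single path that is shortened.
        let cs , path′ , uq′ , ms#′ , ≥2p , ≤2p = reduce _ {ms = D.ms} D.ms-length ≤-refl start (D.pathʳ ++ᵖ D.pathˡ)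
              (unique-swap D.as (unique-⊑ (++⁺ˡ D.ms ⊆-refl) D.unique))
              (λ (z∈ms , z∈) → unique-++⁻-disjoint D.ms D.unique (z∈ms , swap-∈ z∈))
        in close-up {ms = D.ms} D.zigzags path′ uq′ ms#′ ≥2p ≤2p
        where
        4p≤ : 2 * p + 2 * p ≤ length xs + 2
        4p≤ = subst (_≤ length xs + 2) (begin
          2 * (p ∸ 1) + 2 * (p ∸ 1) + 2 + 2     ≡⟨ arith (p ∸ 1) ⟩
          2 * suc (p ∸ 1) + 2 * suc (p ∸ 1)     ≡⟨ cong (λ p → 2 * p + 2 * p) (m+[n∸m]≡n (≤-trans (s≤s z≤n) big)) ⟩
          2 * p + 2 * p                         ∎) (+-monoˡ-≤ 2 long)
          where
          open ≡-Reasoning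
          arith : ∀ q → 2 * q + 2 * q + 2 + 2 ≡ 2 * suc q + 2 * suc q
          arith = solve-∀
        segment+chunk+2≤ : segment K r + chunk K r + 2 ≤ 2 * p
        segment+chunk+2≤ = begin
          segment K r + chunk K r + 2           ≡⟨ +-comm _ 2 ⟩
          suc (suc (segment K r + chunk K r))   ≤⟨ s≤s big₃ ⟩
          suc p                                 ≤⟨ +-monoˡ-≤ p (≤-trans (s≤s z≤n) big) ⟩
          p + p                                 ≡⟨ cong (p +_) (+-identityʳ p) ⟨
          2 * p                                 ∎
          where open ≤-Reasoning
        segment-fits : segment K r ≤ length xs
        segment-fits = +-cancelʳ-≤ 2 _ _ (begin
          segment K r + 2                       ≤⟨ +-monoˡ-≤ 2 (m≤m+n _ _) ⟩
          segment K r + chunk K r + 2           ≤⟨ segment+chunk+2≤ ⟩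
          2 * p                                 ≤⟨ m≤m+n _ _ ⟩
          2 * p + 2 * p                         ≤⟨ 4p≤ ⟩
          length xs + 2                         ∎)
          where open ≤-Reasoning
        module D = Detour (detour uqS small deg r (s≤s z≤n) [] segment-fits big₁ path uq (path-⊆ path) (λ ()))
        swap-∈ : D.bs ++ D.as ⊆ D.as ++ D.bs
        swap-∈ z∈ with ∈-++⁻ D.bs z∈
        ... | inj₁ z∈bs = ∈-++⁺ʳ D.as z∈bs
        ... | inj₂ z∈as = ∈-++⁺ˡ z∈as
        -- The cycle has length at least 4p - 2, and the detour costs at most 2p - 2 of it.
        start : 2 * p ≤ length (D.bs ++ D.as) + 2 * r
        start = ≤-trans (+-cancelʳ-≤ (2 * p) (2 * p) (length (D.bs ++ D.as)) (begin
          2 * p + 2 * p                                    ≤⟨ 4p≤ ⟩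
          length xs + 2                                    ≤⟨ +-monoˡ-≤ 2 D.longer ⟩
          length D.as + length D.bs + (segment K r + chunk K r) + 2
                                                           ≡⟨ +-assoc (length D.as + length D.bs) _ 2 ⟩
          length D.as + length D.bs + (segment K r + chunk K r + 2)
                                                           ≤⟨ +-monoʳ-≤ (length D.as + length D.bs) segment+chunk+2≤ ⟩
          length D.as + length D.bs + 2 * p                ≡⟨ cong (_+ 2 * p) (trans (length-++ D.bs) (+-comm (length D.bs) _)) ⟨
          length (D.bs ++ D.as) + 2 * p                    ∎)) (m≤m+n (length (D.bs ++ D.as)) (2 * r))
          where open ≤-Reasoning

-- Dense graphs: locally maximal cuts and deletion of neighbourhoods.

count-skip : ∀ {A : Set} {P : Pred A 0ℓ} (P? : Decidable P) as {a bs} → ¬ P a →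
  count P? (as ++ a ∷ bs) ≡ count P? (as ++ bs)
count-skip P? as ¬pa = trans (count-++ P? as)
  (trans (cong (λ l → count P? as + length l) (filter-reject P? ¬pa)) (sym (count-++ P? as)))

path-map : ∀ {V : Set} {E F : Rel V 0ℓ} → (∀ {x y} → E x y → F x y) →
  ∀ {x y xs} → Walks.Path E x y xs → Walks.Path F x y xs
path-map f Walks.[]      = Walks.[]
path-map f (e Walks.∷ p) = f e Walks.∷ path-map f p

module DenseGraph {V : Set} (_≟_ : DecidableEquality V) (Adj : Rel V 0ℓ) (adj? : Decidable₂ Adj)
                  (adj-sym : Symmetric Adj) (adj-irrefl : ∀ {x} → ¬ Adj x x) where

  open import Data.List.Membership.DecPropositional _≟_ using (_∈?_)

  crossing : List V → List V → ℕ
  crossing xs ys = sum (map (λ x → count (adj? x) ys) xs)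

  crossing-moveˡ : ∀ as {a bs} ys → crossing (as ++ a ∷ bs) ys ≡ count (adj? a) ys + crossing (as ++ bs) ys
  crossing-moveˡ []       ys = refl
  crossing-moveˡ (x ∷ as) {a} ys =
    trans (cong (count (adj? x) ys +_) (crossing-moveˡ as ys)) (+-swapˡ (count (adj? x) ys) (count (adj? a) ys) _)

  crossing-moveʳ : ∀ xs as {b bs} → crossing xs (as ++ b ∷ bs) ≡ count (adj? b) xs + crossing xs (as ++ bs)
  crossing-moveʳ []       as = refl
  crossing-moveʳ (x ∷ xs) as {b} {bs} with adj? b x
  ... | yes bx = begin
    count (adj? x) (as ++ b ∷ bs) + crossing xs (as ++ b ∷ bs)
      ≡⟨ cong₂ _+_ (trans (count-++ (adj? x) as) (cong (λ l → count (adj? x) as + length l) (filter-accept (adj? x) (adj-sym bx))))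
           (crossing-moveʳ xs as) ⟩
    (count (adj? x) as + suc (count (adj? x) bs)) + (count (adj? b) xs + crossing xs (as ++ bs))
      ≡⟨ arith (count (adj? x) as) (count (adj? x) bs) (count (adj? b) xs) _ ⟩
    suc (count (adj? b) xs + ((count (adj? x) as + count (adj? x) bs) + crossing xs (as ++ bs)))
      ≡⟨ cong (λ l → suc (count (adj? b) xs + (l + crossing xs (as ++ bs)))) (count-++ (adj? x) as) ⟨
    suc (count (adj? b) xs) + (count (adj? x) (as ++ bs) + crossing xs (as ++ bs)) ∎
    where
    open ≡-Reasoning
    arith : ∀ a b c d → (a + suc b) + (c + d) ≡ suc (c + ((a + b) + d))
    arith = solve-∀
  ... | no ¬bx = trans
    (cong₂ _+_ (count-skip (adj? x) as (λ xb → ¬bx (adj-sym xb))) (crossing-moveʳ xs as))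
    (+-swapˡ (count (adj? x) (as ++ bs)) (count (adj? b) xs) _)

  crossing-≤ : ∀ xs ys → crossing xs ys ≤ length xs * length ys
  crossing-≤ []       ys = z≤n
  crossing-≤ (x ∷ xs) ys = +-mono-≤ (length-filter (adj? x) ys) (crossing-≤ xs ys)

  Balanced : List V → List V → Set
  Balanced xs ys = All (λ x → count (adj? x) xs ≤ count (adj? x) ys) xs

  -- Moving a vertex with more neighbours on its own side than on the other increases `crossing`,
  -- which never exceeds the square of `length L`; `f` bounds the number of moves left.
  max-cut : ∀ L f xs ys → xs ++ ys ↭ L → length L * length L < crossing xs ys + f →
    ∃[ xs ] ∃[ ys ] (xs ++ ys ↭ L × Balanced xs ys × Balanced ys xs)
  max-cut L zero xs ys σ lt = contradiction bound (<⇒≱ (subst (length L * length L <_) (+-identityʳ _) lt))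
    where
    total : length xs + length ys ≡ length L
    total = trans (sym (length-++ xs)) (↭-length σ)
    bound : crossing xs ys ≤ length L * length L
    bound = ≤-trans (crossing-≤ xs ys)
      (*-mono-≤ (subst (length xs ≤_) total (m≤m+n _ _)) (subst (length ys ≤_) total (m≤n+m _ _)))
  max-cut L (suc f) xs ys σ lt
    with all? (λ x → count (adj? x) xs ≤? count (adj? x) ys) xs | all? (λ y → count (adj? y) ys ≤? count (adj? y) xs) ys
  ... | yes bal | yes bal′ = xs , ys , σ , bal , bal′
  ... | no ¬bal | _ with find (All.¬All⇒Any¬ (λ x → count (adj? x) xs ≤? count (adj? x) ys) xs ¬bal)
  ...   | a , a∈ , ¬≤ with ∈-∃++ a∈
  ...     | as , bs , refl = max-cut L f (as ++ bs) (a ∷ ys)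
    (↭-trans (shift a (as ++ bs) ys) (↭-trans (↭-++⁺ʳ ys (↭-sym (shift a as bs))) σ))
    (s≤s⁻¹ (begin-strict
      suc (length L * length L)                               ≤⟨ lt ⟩
      crossing (as ++ a ∷ bs) ys + suc f                      ≡⟨ cong (_+ suc f) (crossing-moveˡ as ys) ⟩
      count (adj? a) ys + crossing (as ++ bs) ys + suc f      <⟨ +-monoˡ-< (suc f) (+-monoˡ-< _ gain) ⟩
      count (adj? a) (as ++ bs) + crossing (as ++ bs) ys + suc f
                                                              ≡⟨ cong (_+ suc f) (crossing-moveʳ (as ++ bs) []) ⟨
      crossing (as ++ bs) (a ∷ ys) + suc f                    ≡⟨ +-suc _ f ⟩
      suc (crossing (as ++ bs) (a ∷ ys) + f)                  ∎))
    where
    open ≤-Reasoning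
    gain : count (adj? a) ys < count (adj? a) (as ++ bs)
    gain = subst (count (adj? a) ys <_) (count-skip (adj? a) as adj-irrefl) (≰⇒> ¬≤)
  max-cut L (suc f) xs ys σ lt | yes _ | no ¬bal with find (All.¬All⇒Any¬ (λ y → count (adj? y) ys ≤? count (adj? y) xs) ys ¬bal)
  ...   | b , b∈ , ¬≤ with ∈-∃++ b∈
  ...     | as , bs , refl = max-cut L f (b ∷ xs) (as ++ bs)
    (↭-trans (↭-sym (shift b xs (as ++ bs))) (↭-trans (↭-++⁺ˡ xs (↭-sym (shift b as bs))) σ))
    (s≤s⁻¹ (begin-strict
      suc (length L * length L)                               ≤⟨ lt ⟩
      crossing xs (as ++ b ∷ bs) + suc f                      ≡⟨ cong (_+ suc f) (crossing-moveʳ xs as) ⟩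
      count (adj? b) xs + crossing xs (as ++ bs) + suc f      <⟨ +-monoˡ-< (suc f) (+-monoˡ-< _ gain) ⟩
      crossing (b ∷ xs) (as ++ bs) + suc f                    ≡⟨ +-suc _ f ⟩
      suc (crossing (b ∷ xs) (as ++ bs) + f)                  ∎))
    where
    open ≤-Reasoning
    gain : count (adj? b) xs < count (adj? b) (as ++ bs)
    gain = subst (count (adj? b) xs <_) (count-skip (adj? b) as adj-irrefl) (≰⇒> ¬≤)

  min-degree-cycle : ∀ {p K L v} → threshold K < p → Unique L → length L ≤ suc K * p → v ∈ L →
    All (λ x → 2 * p ≤ suc (count (adj? x) L)) L → Walks.Cycle Adj (2 * p)
  min-degree-cycle {p} {K} {L} {v} big uq small v∈ deg
    with max-cut L (suc (length L * length L)) L [] (↭-reflexive (++-identityʳ L)) (m≤n+m _ (crossing L []))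
  ... | A , B , σ , balA , balB = let x , xs , path , u , len = even-cycle uqS smallS degS S∋ big (∈-resp-↭ (↭-sym σ) v∈)
                                  in x , xs , path-map proj₁ path , u , len
    where
    S = A ++ B
    col : V → Bool
    col x = does (x ∈? A)

    -- `col` also colours vertices outside `S`, so both ends are explicitly required to lie in `S`;
    -- this keeps every path inside it.
    E : Rel V 0ℓ
    E x y = Adj x y × x ∈ S × y ∈ S × col y ≡ not (col x)

    E? : Decidable₂ E
    E? x y = adj? x y ×-dec (x ∈? S) ×-dec (y ∈? S) ×-dec (col y ≟ᵇ not (col x))

    E-sym : Symmetric E
    E-sym (xy , x∈ , y∈ , eq) = adj-sym xy , y∈ , x∈ , sym (trans (cong not eq) (not-involutive _))

    S∋ : ∀ {x y} → E x y → y ∈ S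
    S∋ (_ , _ , y∈ , _) = y∈

    open BipartiteGraph _≟_ E E? E-sym col (proj₂ ∘ proj₂ ∘ proj₂)

    uqS : Unique S
    uqS = unique-↭ (↭-sym σ) uq

    smallS : length S ≤ suc K * p
    smallS = subst (_≤ suc K * p) (sym (↭-length σ)) small

    colA : ∀ {x} → x ∈ A → col x ≡ true
    colA {x} x∈ = dec-true (x ∈? A) x∈

    colB : ∀ {x} → x ∈ B → col x ≡ false
    colB {x} x∈ = dec-false (x ∈? A) λ x∈A → unique-++⁻-disjoint A uqS (x∈A , x∈)

    degree : ∀ {x} → x ∈ S → 2 * p ≤ suc (count (adj? x) A + count (adj? x) B)
    degree {x} x∈ = begin
      2 * p                                            ≤⟨ All.lookup deg (∈-resp-↭ σ x∈) ⟩
      suc (count (adj? x) L)                           ≤⟨ s≤s (count-split (adj? x) (adj? x) S [] uq λ y∈ xy → inj₁ (∈-resp-↭ (↭-sym σ) y∈ , xy)) ⟩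
      suc (count (adj? x) S + 0)                       ≡⟨ cong suc (trans (+-identityʳ _) (count-++ (adj? x) A)) ⟩
      suc (count (adj? x) A + count (adj? x) B)        ∎
      where open ≤-Reasoning

    -- If both numbers were at most p - 1, their sum would fall short of 2p - 1.
    half : ∀ {c d} → 2 * p ≤ suc (c + d) → c ≤ d → p ≤ d
    half {c} {d} le c≤d = ≮⇒≥ λ d<p → <⇒≱ {suc (c + d)} {2 * p} (begin-strict
      suc (c + d)       ≤⟨ s≤s (+-monoˡ-≤ d c≤d) ⟩
      suc (d + d)       <⟨ s≤s (+-monoʳ-< d (n<1+n d)) ⟩
      suc d + suc d     ≤⟨ +-mono-≤ d<p d<p ⟩
      p + p             ≡⟨ cong (p +_) (+-identityʳ p) ⟨
      2 * p             ∎) le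
      where open ≤-Reasoning

    inherit : ∀ {x} T → Unique T → x ∈ S → (∀ {y} → y ∈ T → y ∈ S × col y ≡ not (col x)) →
      count (adj? x) T ≤ count (E? x) S
    inherit {x} T uT x∈ f = subst (count (adj? x) T ≤_) (+-identityʳ _)
      (count-split (adj? x) (E? x) S [] uT λ y∈ xy → inj₁ (proj₁ (f y∈) , xy , x∈ , f y∈))

    degS : All (λ x → p ≤ count (E? x) S) S
    degS = All.tabulate λ x∈ → [ sideA , sideB ]′ (∈-++⁻ A x∈)
      where
      sideA : ∀ {x} → x ∈ A → p ≤ count (E? x) S
      sideA {x} x∈ = ≤-trans (half (degree (∈-++⁺ˡ x∈)) (All.lookup balA x∈))
        (inherit B (unique-⊑ (++⁺ˡ A ⊆-refl) uqS) (∈-++⁺ˡ x∈)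
          λ y∈ → ∈-++⁺ʳ A y∈ , trans (colB y∈) (cong not (sym (colA x∈))))
      sideB : ∀ {x} → x ∈ B → p ≤ count (E? x) S
      sideB {x} x∈ = ≤-trans
        (half (subst (λ n → 2 * p ≤ suc n) (+-comm (count (adj? x) A) _) (degree (∈-++⁺ʳ A x∈))) (All.lookup balB x∈))
        (inherit A (unique-⊑ (++⁺ʳ B ⊆-refl) uqS) (∈-++⁺ʳ A x∈)
          λ y∈ → ∈-++⁺ˡ y∈ , trans (colA y∈) (cong not (sym (colB x∈))))

  -- Each spine vertex is compared only with what follows it, matching the order in which vertices
  -- are split off together with their neighbourhoods.
  Book : List V → List V → Set
  Book []       ys = Unique ys
  Book (x ∷ xs) ys = All (λ y → x ≢ y × ¬ Adj x y) (xs ++ ys) × Book xs ys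

  -- Induction on the spine length `j`, with m = 2p - 1. A vertex of low degree takes at most `m`
  -- vertices away with its closed neighbourhood, which is exactly what one spine vertex less saves.
  -- With no spine left, the m + 1 remaining vertices needed are the pages.
  cycle-or-book : ∀ {p K m} → threshold K < p → 2 * p ≡ suc m →
    ∀ j L → suc (suc j * m) ≤ suc K * p → Unique L → suc (suc j * m) ≤ length L →
    Walks.Cycle Adj (2 * p) ⊎ ∃[ xs ] ∃[ ys ] (xs ++ ys ⊆ L × length xs ≡ j × length ys ≡ 2 * p × Book xs ys)
  cycle-or-book {p} {K} {m} big 2p≡ zero L small uq long =
    inj₂ ([] , take (2 * p) L , ⊑⇒⊆ (take-⊆ (2 * p) L) , refl ,
      trans (length-take (2 * p) L) (m≤n⇒m⊓n≡m (subst (_≤ length L) (trans (cong suc (+-identityʳ m)) (sym 2p≡)) long)) ,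
      Unique.take⁺ (2 * p) uq)
  cycle-or-book {p} {K} {m} big 2p≡ (suc j) L₀ small uq₀ long₀
    with all? (λ x → 2 * p ≤? suc (count (adj? x) (take (suc (suc (suc j) * m)) L₀))) (take (suc (suc (suc j) * m)) L₀)
  ... | yes deg = inj₁ (min-degree-cycle {K = K} {v = v} big uq (≤-trans (≤-reflexive L-length) small) v∈ deg)
    where
    -- The list is cut to exactly this length because the search for a cycle needs an upper bound on
    -- the order, whereas `long₀` is only a lower bound.
    L = take (suc (suc (suc j) * m)) L₀
    uq : Unique L
    uq = Unique.take⁺ _ uq₀
    L-length : length L ≡ suc (suc (suc j) * m)
    L-length = trans (length-take _ L₀) (m≤n⇒m⊓n≡m long₀)
    inhabited : ∀ {n} (xs : List V) → length xs ≡ suc n → ∃[ x ] x ∈ xs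
    inhabited (x ∷ _) _ = x , here refl
    v = proj₁ (inhabited L L-length)
    v∈ = proj₂ (inhabited L L-length)
  ... | no ¬deg with find (All.¬All⇒Any¬ (λ x → 2 * p ≤? suc (count (adj? x) (take (suc (suc (suc j) * m)) L₀))) _ ¬deg)
  ...   | v , v∈ , low = extend (cycle-or-book big 2p≡ j M (≤-trans (s≤s (m≤n+m _ m)) small) (Unique.filter⁺ (∁? Near?) uq) M-long)
    where
    L = take (suc (suc (suc j) * m)) L₀
    uq : Unique L
    uq = Unique.take⁺ _ uq₀
    L-length : length L ≡ suc (suc (suc j) * m)
    L-length = trans (length-take _ L₀) (m≤n⇒m⊓n≡m long₀)
    Near? : Decidable (λ z → v ≡ z ⊎ Adj v z)
    Near? z = (v ≟ z) ⊎-dec adj? v z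
    M = filter (∁? Near?) L
    near≤ : count Near? L ≤ m
    near≤ = begin
      count Near? L                    ≤⟨ count-split Near? (adj? v) L [ v ] uq (λ z∈ → λ { (inj₁ refl) → inj₂ (here refl) ; (inj₂ vz) → inj₁ (z∈ , vz) }) ⟩
      count (adj? v) L + 1             ≡⟨ +-comm _ 1 ⟩
      suc (count (adj? v) L)           ≤⟨ s≤s⁻¹ (subst (suc (count (adj? v) L) <_) 2p≡ (≰⇒> low)) ⟩
      m                                ∎
      where open ≤-Reasoning
    M-long : suc (suc j * m) ≤ length M
    M-long = +-cancelˡ-≤ m _ _ (begin
      m + suc (suc j * m)              ≡⟨ +-suc m _ ⟩
      suc (suc (suc j) * m)            ≡⟨ L-length ⟨
      length L                         ≡⟨ count-∁ Near? L ⟨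
      count Near? L + length M         ≤⟨ +-monoˡ-≤ _ near≤ ⟩
      m + length M                     ∎)
      where open ≤-Reasoning
    extend : Walks.Cycle Adj (2 * p) ⊎ ∃[ xs ] ∃[ ys ] (xs ++ ys ⊆ M × length xs ≡ j × length ys ≡ 2 * p × Book xs ys) →
      Walks.Cycle Adj (2 * p) ⊎ ∃[ xs ] ∃[ ys ] (xs ++ ys ⊆ L₀ × length xs ≡ suc j × length ys ≡ 2 * p × Book xs ys)
    extend (inj₁ cycle) = inj₁ cycle
    extend (inj₂ (xs , ys , ⊆M , lx , ly , book)) = inj₂
      ( v ∷ xs , ys
      , (λ { (here refl) → ⊑⇒⊆ (take-⊆ _ L₀) v∈ ; (there z∈) → ⊑⇒⊆ (take-⊆ _ L₀) (⊑⇒⊆ (filter-⊆ (∁? Near?) L) (⊆M z∈)) })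
      , cong suc lx , ly
      , All.tabulate (λ z∈ → let ¬near = proj₂ (∈-filter⁻ (∁? Near?) {xs = L} (⊆M z∈)) in ¬near ∘ inj₁ , ¬near ∘ inj₂)
      , book )

-- From lists of vertices to embeddings of graphs.

lookup-injective : ∀ {A : Set} {xs : List A} → Unique xs → ∀ i j → lookup xs i ≡ lookup xs j → i ≡ j
lookup-injective (_ ∷ _)  zero    zero    _  = refl
lookup-injective (x≢ ∷ _) zero    (suc j) eq = contradiction eq (All.lookup x≢ (∈-lookup j))
lookup-injective (x≢ ∷ _) (suc i) zero    eq = contradiction (sym eq) (All.lookup x≢ (∈-lookup i))
lookup-injective (_ ∷ u)  (suc i) (suc j) eq = cong suc (lookup-injective u i j eq)

module _ {N : ℕ} (Γ : Graph N) where

  open Graph Γ using (adj?) renaming (sym to adj-sym)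
  open Walks (Adj Γ)
  open DenseGraph _≟ᶠ_ (Adj Γ) adj? adj-sym (Graph.irrefl Γ refl) using (Book; cycle-or-book)

  path-step : ∀ {x z xs} → Path x z xs → ∀ i j → suc (toℕ i) ≡ toℕ j → Adj Γ (lookup xs i) (lookup xs j)
  path-step (_ ∷ e ∷ _) zero    (suc zero)    _  = e
  path-step (_ ∷ p)     (suc i) (suc j)       eq = path-step p i j (suc-injective eq)

  path-first : ∀ {x z xs} → Path x z xs → ∀ j → toℕ j ≡ 0 → Adj Γ x (lookup xs j)
  path-first (e ∷ _) zero _ = e

  path-last : ∀ {x z xs} → Path x z xs → ∀ i → suc (toℕ i) ≡ length xs → lookup xs i ≡ z
  path-last (_ ∷ [])    zero    _  = refl
  path-last (_ ∷ e ∷ p) (suc i) eq = path-last (e ∷ p) i (suc-injective eq)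

  contains-cycle : ∀ {n} → Cycle n → Contains Γ (cycle n)
  contains-cycle (x , xs , path , uq , refl) =
    mk↣ {to = lookup xs} (lookup-injective uq _ _) ,
    λ { i j (_ , inj₁ ij) → forward i j ij ; i j (_ , inj₂ ji) → adj-sym (forward j i ji) }
    where
    forward : ∀ i j → CyclicSuc i j → Adj Γ (lookup xs i) (lookup xs j)
    forward i j (inj₁ step)            = path-step path i j step
    -- The list ends in the start vertex `x` itself, so the wrap-around edge is the first edge of
    -- the path.
    forward i j (inj₂ (last , first)) =
      subst (λ z → Adj Γ z (lookup xs j)) (sym (path-last path i last)) (path-first path j first)

  book-unique : ∀ xs {ys} → Book xs ys → Unique (xs ++ ys)
  book-unique []       uq         = uq
  book-unique (x ∷ xs) (x~ , bk)  = All.map proj₁ x~ ∷ book-unique xs bk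

  book-adjacent : ∀ xs {ys} → Book xs ys → ∀ i j → i ≢ j → toℕ i < length xs →
    Adj (complement Γ) (lookup (xs ++ ys) i) (lookup (xs ++ ys) j)
  book-adjacent (x ∷ xs) _         zero    zero    i≢j _        = contradiction refl i≢j
  book-adjacent (x ∷ xs) (x~ , _)  zero    (suc j) _   _        = All.lookup x~ (∈-lookup j)
  book-adjacent (x ∷ xs) (x~ , _)  (suc i) zero    _   _        = Graph.sym (complement Γ) (All.lookup x~ (∈-lookup i))
  book-adjacent (x ∷ xs) (_ , bk)  (suc i) (suc j) i≢j (s≤s i<) = book-adjacent xs bk i j (i≢j ∘ cong suc) i<

  contains-book : ∀ {k n} xs ys → length xs ≡ k → length ys ≡ n → Book xs ys → Contains (complement Γ) (book k n)
  contains-book xs ys refl refl bk =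
    mk↣ {to = lookup (xs ++ ys) ∘ index} (λ eq → index-injective (lookup-injective (book-unique xs bk) _ _ eq)) ,
    λ { i j (i≢j , inj₁ i<) → adjacent i j i≢j i<
      ; i j (i≢j , inj₂ j<) → Graph.sym (complement Γ) {lookup (xs ++ ys) (index j)} {lookup (xs ++ ys) (index i)} (adjacent j i (i≢j ∘ sym) j<) }
    where
    index : Fin (length xs + length ys) → Fin (length (xs ++ ys))
    index = cast (sym (length-++ xs))
    index-toℕ : ∀ i → toℕ (index i) ≡ toℕ i
    index-toℕ = toℕ-cast (sym (length-++ xs))
    index-injective : ∀ {i j} → index i ≡ index j → i ≡ j
    index-injective {i} {j} eq = toℕ-injective (trans (sym (index-toℕ i)) (trans (cong toℕ eq) (index-toℕ j)))
    adjacent : ∀ i j → i ≢ j → toℕ i < length xs → Adj (complement Γ) (lookup (xs ++ ys) (index i)) (lookup (xs ++ ys) (index j))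
    adjacent i j i≢j i< = book-adjacent xs bk (index i) (index j) (i≢j ∘ index-injective) (subst (_< length xs) (sym (index-toℕ i)) i<)

-- For K = 1 + 2k the bound `suc K * p` equals (k + 1) · 2p, which is at least the order (k + 1) (2p
-- - 1) + 1.
ramsey-upper : ∀ k p m → threshold (1 + 2 * k) < p → 2 * p ≡ suc m →
  RamseyProperty (cycle (2 * p)) (book k (2 * p)) (suc (suc k * m))
ramsey-upper k p m big 2p≡ Γ =
  [ inj₁ ∘ contains-cycle Γ , (λ (xs , ys , _ , lx , ly , bk) → inj₂ (contains-book Γ xs ys lx ly bk)) ]′
    (DenseGraph.cycle-or-book _≟ᶠ_ (Adj Γ) (Graph.adj? Γ) (Graph.sym Γ) (Graph.irrefl Γ refl)
      {K = 1 + 2 * k} big 2p≡ k (allFin _) small (Unique.allFin⁺ _) (≤-reflexive (sym (length-tabulate id))))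
  where
  small : suc (suc k * m) ≤ suc (1 + 2 * k) * p
  small = begin
    suc (suc k * m)             ≤⟨ s≤s (m≤n+m (suc k * m) k) ⟩
    suc k + suc k * m           ≡⟨ *-suc (suc k) m ⟨
    suc k * suc m               ≡⟨ cong (suc k *_) 2p≡ ⟨
    suc k * (2 * p)             ≡⟨ arith k p ⟩
    suc (1 + 2 * k) * p         ∎
    where
    open ≤-Reasoning
    arith : ∀ k p → suc k * (2 * p) ≡ suc (1 + 2 * k) * p
    arith = solve-∀

-- The lower bound from disjoint cliques.

module DisjointCliques (c m M : ℕ) (M≤ : M ≤ c * m) where

  -- Minimality concerns every smaller order, so the first `M` places of a `c` by `m` array are
  -- used; its rows are the cliques, possibly incomplete.
  position : Fin M → Fin c × Fin m
  position v = remQuot m (inject≤ v M≤)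

  clique : Fin M → Fin c
  clique = proj₁ ∘ position

  position-injective : ∀ {u v} → position u ≡ position v → u ≡ v
  position-injective {u} {v} eq = inject≤-injective M≤ M≤ u v
    (trans (sym (combine-remQuot {c} m _)) (trans (cong (λ (q , r) → combine q r) eq) (combine-remQuot {c} m _)))

  cliques : Graph M
  cliques = record
    { Adj    = λ u v → u ≢ v × clique u ≡ clique v
    ; sym    = λ (u≢v , eq) → u≢v ∘ sym , sym eq
    ; irrefl = λ u≡v (u≢v , _) → u≢v u≡v
    ; adj?   = λ u v → ¬? (u ≟ᶠ v) ×-dec (clique u ≟ᶠ clique v)
    }

  clique-small : ∀ {n} → m < n → (f : Fin n → Fin M) → Injective _≡_ _≡_ f → ¬ (∀ i j → clique (f i) ≡ clique (f j))
  clique-small m<n f inj same with pigeonhole m<n (proj₂ ∘ position ∘ f)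
  ... | i , j , i<j , eq = <⇒≢ i<j (cong toℕ (inj (position-injective (cong₂ _,_ (same i j) eq))))

  -- Consecutive vertices of a cycle share a clique, so all `suc m` of them would lie in a clique on
  -- at most `m` vertices.
  no-cycle : ¬ Contains cliques (cycle (suc m))
  no-cycle (f , hom) = clique-small ≤-refl (Injection.to f) (Injection.injective f)
    (λ i j → trans (constant i) (sym (constant j)))
    where
    constant : ∀ i → clique (Injection.to f i) ≡ clique (Injection.to f zero)
    constant = <-weakInduction _ refl λ i ih → trans (sym (proj₂ (hom (inject₁ i) (suc i)
      ( (λ eq → 1+n≢n (sym (trans (sym (toℕ-inject₁ i)) (cong toℕ eq)))) , inj₁ (inj₁ (cong suc (toℕ-inject₁ i)))))))  ih

  -- The spine occupies `k` different cliques, and no page lies in any of them. Two pages in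
  -- different cliques would make k + 2 cliques where there are k + 1, so all pages share one
  -- clique, which is too small for them.
  no-book : ∀ k → c ≡ suc k → ¬ Contains (complement cliques) (book k (suc m))
  no-book k refl (f , hom) = clique-small ≤-refl page page-injective same
    where
    g = Injection.to f
    page : Fin (suc m) → Fin M
    page y = g (k ↑ʳ y)
    spine : Fin k → Fin M
    spine x = g (x ↑ˡ suc m)
    page-injective : Injective _≡_ _≡_ page
    page-injective eq = ↑ʳ-injective k _ _ (Injection.injective f eq)

    separate : ∀ {u} x → x ↑ˡ suc m ≢ u → clique (spine x) ≢ clique (g u)
    separate {u} x x≢u eq with hom (x ↑ˡ suc m) u (x≢u , inj₁ (subst (_< k) (sym (toℕ-↑ˡ x (suc m))) (toℕ<n x)))
    ... | g≢ , ¬adj = ¬adj (g≢ , eq)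

    spine-page : ∀ x y → clique (spine x) ≢ clique (page y)
    spine-page x y = separate x λ eq → <⇒≱ (subst (_< k) (trans (sym (toℕ-↑ˡ x (suc m))) (trans (cong toℕ eq) (toℕ-↑ʳ k y))) (toℕ<n x)) (m≤m+n k _)

    same : ∀ y y′ → clique (page y) ≡ clique (page y′)
    same y y′ with clique (page y) ≟ᶠ clique (page y′)
    ... | yes eq = eq
    ... | no  ne = ⊥-elim (clash (pigeonhole ≤-refl h))
      where
      h : Fin (2 + k) → Fin (suc k)
      h zero          = clique (page y)
      h (suc zero)    = clique (page y′)
      h (suc (suc x)) = clique (spine x)
      clash : ¬ (∃[ i ] ∃[ j ] (i Fin.< j × h i ≡ h j))
      clash (zero , suc zero , _ , eq)          = ne eq
      clash (zero , suc (suc x) , _ , eq)       = spine-page x y (sym eq)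
      clash (suc zero , suc zero , s≤s () , _)
      clash (suc zero , suc (suc x) , _ , eq)   = spine-page x y′ (sym eq)
      clash (suc (suc x) , suc zero , s≤s () , _)
      clash (suc (suc x) , suc (suc x′) , x<x′ , eq) =
        separate x (λ eq′ → <⇒≢ x<x′ (cong (λ z → suc (suc (toℕ z))) (↑ˡ-injective (suc m) x x′ eq′))) eq

ramsey-lower : ∀ k m M → RamseyProperty (cycle (suc m)) (book k (suc m)) M → suc (suc k * m) ≤ M
ramsey-lower k m M ramsey = ≮⇒≥ λ M< →
  let open DisjointCliques (suc k) m M (s≤s⁻¹ M<)
  in [ no-cycle , no-book k refl ]′ (ramsey cliques)

-- The two bounds combined.

corollary1p1 : ∀ (k : ℕ) → k ≥ 1 →
    ∃[ n₀ ] (n₀ ≥ 1 ×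
    (∀ (n : ℕ) → n ≥ n₀ → 2 ∣ n →
    IsRamseyNumber (cycle n) (book k n) ((k + 1) * (n ∸ 1) + 1)))
-- For n = 2p, the condition n ≥ 2 (T + 1) amounts to `T < p`, as the upper bound requires.
corollary1p1 k _ = 2 * suc T , s≤s z≤n , λ { n n≥ (divides p eq) → number n p (trans eq (*-comm p 2)) n≥ }
  where
  T = threshold (1 + 2 * k)
  number : ∀ n p → n ≡ 2 * p → 2 * suc T ≤ n → IsRamseyNumber (cycle n) (book k n) ((k + 1) * (n ∸ 1) + 1)
  number .(2 * suc p) (suc p) refl n≥ = subst (IsRamseyNumber (cycle (2 * suc p)) (book k (2 * suc p))) size
    (ramsey-upper k (suc p) (2 * suc p ∸ 1) (*-cancelˡ-≤ 2 n≥) refl , ramsey-lower k (2 * suc p ∸ 1))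
    where
    size : suc (suc k * (2 * suc p ∸ 1)) ≡ (k + 1) * (2 * suc p ∸ 1) + 1
    size = trans (+-comm 1 (suc k * (2 * suc p ∸ 1))) (cong (λ c → c * (2 * suc p ∸ 1) + 1) (+-comm 1 k))
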